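{- Let $m$ be an odd positive integer and let $r,s\in\mathbb{Z}$ satisfy $2^{ -1}+r^2+s^2\equiv 0\pmod m$, where $2^{ -1}$ is the inverse of $2$ modulo $m$. Every $\mathbf{q}\in H_{1,2,2}$ is congruent modulo $mH_{1,2,2}$ to an element $q_1+q_2\mathbf{i}+q_3\sqrt2\,\mathbf{j}+q_4\sqrt2\,\mathbf{k}$ with $q_1,\dots,q_4\in\mathbb{Z}$; define $$\tau(\mathbf{q})=\begin{pmatrix}\alpha&\beta\\ \gamma&\delta\end{pmatrix},\quad \alpha=q_1-2rq_3-2sq_4,\ \beta=q_2-2sq_3+2rq_4,\ \gamma=-q_2-2sq_3+2rq_4,\ \delta=q_1+2rq_3+2sq_4,$$ with entries taken modulo $m$. Then $\tau$ is a well-defined ring isomorphism from $H_{1,2,2}/mH_{1,2,2}$ onto the ring $M_2(\mathbb{Z}/m\mathbb{Z})$ of $2\times2$ matrices over $\mathbb{Z}/m\mathbb{Z}$, and $\det\tau(\mathbf{q})\equiv N(\mathbf{q})\pmod m$ for all $\mathbf{q}\in H_{1,2,2}$.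
   Context: Let $\mathbf{i},\mathbf{j},\mathbf{k}$ be the standard quaternion units; $\overline{\mathbf{q}}$ is quaternion conjugation and $N(\mathbf{q})=\mathbf{q}\overline{\mathbf{q}}$. $H_{1,2,2}$ is the subring of the quaternions equal to the $\mathbb{Z}$-module generated by $\mathbf{v}_1=1$, $\mathbf{v}_2=\mathbf{i}$, $\mathbf{v}_3=\tfrac12(1+\mathbf{i}+\sqrt2\,\mathbf{j})$, $\mathbf{v}_4=\tfrac12(1+\mathbf{i}+\sqrt2\,\mathbf{k})$; the norm takes integer values on it. Such $r,s$ exist for every odd $m$. -}

module Defs where

open import Algebra.Bundles using (Ring; CommutativeRing; RawRing)
open import Algebra.Morphism.Structures using (IsRingMonomorphism)
import Algebra.Morphism.RingMonomorphism as RingMonomorphism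
import Algebra.Properties.AbelianGroup as AbelianGroupProperties
import Algebra.Properties.CommutativeMonoid.Mult as Mult
import Algebra.Properties.Ring as RingProperties
import Algebra.Properties.Semiring.Mult as SemiringMult
import Algebra.Properties.Semiring.Sum as SemiringSum
import Algebra.Solver.Ring as RingSolver
import Algebra.Solver.Ring.AlmostCommutativeRing as ACR
import Algebra.Solver.Ring.NaturalCoefficients.Default as SemiringSolver
open import Data.Fin.Base using (Fin)
open import Data.Fin.Patterns using (0F; 1F; 2F; 3F)
import Data.Integer.Base
open import Data.Integer.Base as ℤ using (ℤ; +_; 0ℤ; 1ℤ; -1ℤ)
import Data.Integer.Properties as ℤ
import Data.Integer.Solver as ℤ
import Data.Maybe.Base as Maybe
open import Data.Nat.Base as ℕ using (ℕ; zero; suc)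
open import Data.Product.Base using (∃; _,_; proj₁)
open import Data.Rational.Base as ℚ using (ℚ; 0ℚ; 1ℚ; ½; toℚᵘ)
import Data.Rational.Properties as ℚ
import Data.Rational.Solver as ℚ
open import Data.Rational.Unnormalised.Base as ℚᵘ using (mkℚᵘ; *≡*)
import Data.Rational.Unnormalised.Properties as ℚᵘ
open import Data.Vec.Functional using (Vector; []; _∷_)
open import Level using (0ℓ; _⊔_)
open import Relation.Binary.PropositionalEquality
  using (_≡_; refl; sym; trans; cong; cong₂; subst; isEquivalence; module ≡-Reasoning)
open import Relation.Nullary.Decidable using (dec⇒maybe)

ℤ→ℚ : ℤ → ℚ
ℤ→ℚ n = n ℚ./ 1

toℚᵘ-ℤ→ℚ : ∀ n → toℚᵘ (ℤ→ℚ n) ℚᵘ.≃ mkℚᵘ n 0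
toℚᵘ-ℤ→ℚ n = ℚ.toℚᵘ-fromℚᵘ (mkℚᵘ n 0)

ℤ→ℚ-homo-+ : ∀ m n → ℤ→ℚ (m ℤ.+ n) ≡ ℤ→ℚ m ℚ.+ ℤ→ℚ n
ℤ→ℚ-homo-+ m n = ℚ.toℚᵘ-injective (begin-equality
  toℚᵘ (ℤ→ℚ (m ℤ.+ n))              ≃⟨ toℚᵘ-ℤ→ℚ (m ℤ.+ n) ⟩
  mkℚᵘ (m ℤ.+ n) 0                  ≃⟨ *≡* (solve 2 (λ m n → (m :+ n) :* con 1ℤ
                                         := (m :* con 1ℤ :+ n :* con 1ℤ) :* con 1ℤ) refl m n) ⟩
  mkℚᵘ m 0 ℚᵘ.+ mkℚᵘ n 0            ≃⟨ ℚᵘ.+-cong (toℚᵘ-ℤ→ℚ m) (toℚᵘ-ℤ→ℚ n) ⟨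
  toℚᵘ (ℤ→ℚ m) ℚᵘ.+ toℚᵘ (ℤ→ℚ n)    ≃⟨ ℚ.toℚᵘ-homo-+ (ℤ→ℚ m) (ℤ→ℚ n) ⟨
  toℚᵘ (ℤ→ℚ m ℚ.+ ℤ→ℚ n)            ∎)
  where
  open ℚᵘ.≤-Reasoning
  open ℤ.+-*-Solver

ℤ→ℚ-homo-* : ∀ m n → ℤ→ℚ (m ℤ.* n) ≡ ℤ→ℚ m ℚ.* ℤ→ℚ n
ℤ→ℚ-homo-* m n = ℚ.toℚᵘ-injective (begin-equality
  toℚᵘ (ℤ→ℚ (m ℤ.* n))              ≃⟨ toℚᵘ-ℤ→ℚ (m ℤ.* n) ⟩
  mkℚᵘ (m ℤ.* n) 0                  ≃⟨ *≡* refl ⟩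
  mkℚᵘ m 0 ℚᵘ.* mkℚᵘ n 0            ≃⟨ ℚᵘ.*-cong (toℚᵘ-ℤ→ℚ m) (toℚᵘ-ℤ→ℚ n) ⟨
  toℚᵘ (ℤ→ℚ m) ℚᵘ.* toℚᵘ (ℤ→ℚ n)    ≃⟨ ℚ.toℚᵘ-homo-* (ℤ→ℚ m) (ℤ→ℚ n) ⟨
  toℚᵘ (ℤ→ℚ m ℚ.* ℤ→ℚ n)            ∎)
  where open ℚᵘ.≤-Reasoning

ℤ→ℚ-homo‿- : ∀ n → ℤ→ℚ (ℤ.- n) ≡ ℚ.- ℤ→ℚ n
ℤ→ℚ-homo‿- n = ℚ.toℚᵘ-injective (begin-equality
  toℚᵘ (ℤ→ℚ (ℤ.- n))   ≃⟨ toℚᵘ-ℤ→ℚ (ℤ.- n) ⟩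
  mkℚᵘ (ℤ.- n) 0       ≃⟨ *≡* refl ⟩
  ℚᵘ.- mkℚᵘ n 0        ≃⟨ ℚᵘ.-‿cong (toℚᵘ-ℤ→ℚ n) ⟨
  ℚᵘ.- toℚᵘ (ℤ→ℚ n)    ≃⟨ ℚ.toℚᵘ-homo‿- (ℤ→ℚ n) ⟨
  toℚᵘ (ℚ.- ℤ→ℚ n)     ∎)
  where open ℚᵘ.≤-Reasoning

-- The standard library has no real numbers.  The coordinates of every
-- element of H₁₂₂ lie in ℚ(√2) ⊂ ℝ, so quaternions over ℚ(√2) suffice
-- as the ambient ring.

data ℚ√2 : Set where
  _+√2_ : (a b : ℚ) → ℚ√2

infix 5 _+√2_

2ℚ : ℚ
2ℚ = + 2 ℚ./ 1

√2 : ℚ√2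
√2 = 0ℚ +√2 1ℚ

module ℚ√2-Ops where
  infixl 6 _+_
  infixl 7 _*_
  infix  8 -_

  _+_ _*_ : ℚ√2 → ℚ√2 → ℚ√2
  (a +√2 b) + (c +√2 d) = (a ℚ.+ c) +√2 (b ℚ.+ d)
  (a +√2 b) * (c +√2 d) =
    (a ℚ.* c ℚ.+ 2ℚ ℚ.* (b ℚ.* d)) +√2 (a ℚ.* d ℚ.+ b ℚ.* c)

  -_ : ℚ√2 → ℚ√2
  - (a +√2 b) = (ℚ.- a) +√2 (ℚ.- b)

ℚ√2-commutativeRing : CommutativeRing 0ℓ 0ℓ
ℚ√2-commutativeRing = record
  { Carrier = ℚ√2 ; _≈_ = _≡_ ; _+_ = _+_ ; _*_ = _*_ ; -_ = -_
  ; 0# = 0ℚ +√2 0ℚ ; 1# = 1ℚ +√2 0ℚ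
  ; isCommutativeRing = record
    { isRing = record
      { +-isAbelianGroup = record
        { isGroup = record
          { isMonoid = record
            { isSemigroup = record
              { isMagma = record { isEquivalence = isEquivalence ; ∙-cong = cong₂ _+_ }
              ; assoc = λ { (a +√2 b) (c +√2 d) (e +√2 f) →
                  cong₂ _+√2_ (ℚ.+-assoc a c e) (ℚ.+-assoc b d f) }
              }
            ; identity =
                (λ { (a +√2 b) → cong₂ _+√2_ (ℚ.+-identityˡ a) (ℚ.+-identityˡ b) })
              , (λ { (a +√2 b) → cong₂ _+√2_ (ℚ.+-identityʳ a) (ℚ.+-identityʳ b) })
            }
          ; inverse =
              (λ { (a +√2 b) → cong₂ _+√2_ (ℚ.+-inverseˡ a) (ℚ.+-inverseˡ b) })
            , (λ { (a +√2 b) → cong₂ _+√2_ (ℚ.+-inverseʳ a) (ℚ.+-inverseʳ b) })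
          ; ⁻¹-cong = cong -_
          }
        ; comm = λ { (a +√2 b) (c +√2 d) →
            cong₂ _+√2_ (ℚ.+-comm a c) (ℚ.+-comm b d) }
        }
      ; *-cong = cong₂ _*_
      ; *-assoc = λ { (a +√2 b) (c +√2 d) (e +√2 f) → cong₂ _+√2_
          (solve 6 (λ a b c d e f →
             (a :* c :+ con 2ℚ :* (b :* d)) :* e :+ con 2ℚ :* ((a :* d :+ b :* c) :* f)
             := a :* (c :* e :+ con 2ℚ :* (d :* f)) :+ con 2ℚ :* (b :* (c :* f :+ d :* e)))
             refl a b c d e f)
          (solve 6 (λ a b c d e f →
             (a :* c :+ con 2ℚ :* (b :* d)) :* f :+ (a :* d :+ b :* c) :* e
             := a :* (c :* f :+ d :* e) :+ b :* (c :* e :+ con 2ℚ :* (d :* f)))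
             refl a b c d e f) }
      ; *-identity =
          (λ { (a +√2 b) → cong₂ _+√2_
            (solve 2 (λ a b → con 1ℚ :* a :+ con 2ℚ :* (con 0ℚ :* b) := a) refl a b)
            (solve 2 (λ a b → con 1ℚ :* b :+ con 0ℚ :* a := b) refl a b) })
        , (λ { (a +√2 b) → cong₂ _+√2_
            (solve 2 (λ a b → a :* con 1ℚ :+ con 2ℚ :* (b :* con 0ℚ) := a) refl a b)
            (solve 2 (λ a b → a :* con 0ℚ :+ b :* con 1ℚ := b) refl a b) })
      ; distrib =
          (λ { (a +√2 b) (c +√2 d) (e +√2 f) → cong₂ _+√2_
            (solve 6 (λ a b c d e f →
               a :* (c :+ e) :+ con 2ℚ :* (b :* (d :+ f))
               := (a :* c :+ con 2ℚ :* (b :* d)) :+ (a :* e :+ con 2ℚ :* (b :* f)))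
               refl a b c d e f)
            (solve 6 (λ a b c d e f →
               a :* (d :+ f) :+ b :* (c :+ e)
               := (a :* d :+ b :* c) :+ (a :* f :+ b :* e))
               refl a b c d e f) })
        , (λ { (a +√2 b) (c +√2 d) (e +√2 f) → cong₂ _+√2_
            (solve 6 (λ a b c d e f →
               (c :+ e) :* a :+ con 2ℚ :* ((d :+ f) :* b)
               := (c :* a :+ con 2ℚ :* (d :* b)) :+ (e :* a :+ con 2ℚ :* (f :* b)))
               refl a b c d e f)
            (solve 6 (λ a b c d e f →
               (c :+ e) :* b :+ (d :+ f) :* a
               := (c :* b :+ d :* a) :+ (e :* b :+ f :* a))
               refl a b c d e f) })
      }
    ; *-comm = λ { (a +√2 b) (c +√2 d) → cong₂ _+√2_
        (solve 4 (λ a b c d →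
           a :* c :+ con 2ℚ :* (b :* d) := c :* a :+ con 2ℚ :* (d :* b)) refl a b c d)
        (solve 4 (λ a b c d → a :* d :+ b :* c := c :* b :+ d :* a) refl a b c d) }
    }
  }
  where
  open ℚ√2-Ops
  open ℚ.+-*-Solver

ℤ→ℚ√2 : ℤ → ℚ√2
ℤ→ℚ√2 n = ℤ→ℚ n +√2 0ℚ

ℤ→ℚ√2-homo-+ : ∀ m n → ℤ→ℚ√2 (m ℤ.+ n) ≡ ℤ→ℚ√2 m ℚ√2-Ops.+ ℤ→ℚ√2 n
ℤ→ℚ√2-homo-+ m n = cong (_+√2 0ℚ) (ℤ→ℚ-homo-+ m n)

ℤ→ℚ√2-homo-* : ∀ m n → ℤ→ℚ√2 (m ℤ.* n) ≡ ℤ→ℚ√2 m ℚ√2-Ops.* ℤ→ℚ√2 n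
ℤ→ℚ√2-homo-* m n = trans (cong (_+√2 0ℚ) (ℤ→ℚ-homo-* m n)) (cong₂ _+√2_
  (solve 2 (λ a b → a :* b := a :* b :+ con 2ℚ :* (con 0ℚ :* con 0ℚ)) refl (ℤ→ℚ m) (ℤ→ℚ n))
  (solve 2 (λ a b → con 0ℚ := a :* con 0ℚ :+ con 0ℚ :* b) refl (ℤ→ℚ m) (ℤ→ℚ n)))
  where open ℚ.+-*-Solver

-- Integer coefficients: normalising rational ones is far too slow.
module ℚ√2-Solver where
  ℚ√2-almostCommutativeRing : ACR.AlmostCommutativeRing 0ℓ 0ℓ
  ℚ√2-almostCommutativeRing = ACR.fromCommutativeRing ℚ√2-commutativeRing

  ℤ⟶ℚ√2 : ℤ.+-*-rawRing ACR.-Raw-AlmostCommutative⟶ ℚ√2-almostCommutativeRing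
  ℤ⟶ℚ√2 = record
    { ⟦_⟧    = ℤ→ℚ√2
    ; +-homo = ℤ→ℚ√2-homo-+
    ; *-homo = ℤ→ℚ√2-homo-*
    ; -‿homo = λ n → cong (_+√2 0ℚ) (ℤ→ℚ-homo‿- n)
    ; 0-homo = refl
    ; 1-homo = refl
    }

  open RingSolver ℤ.+-*-rawRing ℚ√2-almostCommutativeRing ℤ⟶ℚ√2
    (λ m n → Maybe.map (cong ℤ→ℚ√2) (dec⇒maybe (m ℤ.≟ n))) public

data Quaternion : Set where
  quat : (a b c d : ℚ√2) → Quaternion

module ℍ-Ops where
  private module K = CommutativeRing ℚ√2-commutativeRing
  infixl 6 _+_
  infixl 7 _*_
  infix  8 -_

  _+_ _*_ : Quaternion → Quaternion → Quaternion
  quat a b c d + quat e f g h = quat (a K.+ e) (b K.+ f) (c K.+ g) (d K.+ h)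
  quat a b c d * quat e f g h = quat
    (a K.* e K.- b K.* f K.- c K.* g K.- d K.* h)
    (a K.* f K.+ b K.* e K.+ c K.* h K.- d K.* g)
    (a K.* g K.- b K.* h K.+ c K.* e K.+ d K.* f)
    (a K.* h K.+ b K.* g K.- c K.* f K.+ d K.* e)

  -_ : Quaternion → Quaternion
  - quat a b c d = quat (K.- a) (K.- b) (K.- c) (K.- d)

  scalar : ℚ√2 → Quaternion
  scalar a = quat a K.0# K.0# K.0#

  𝐢 𝐣 𝐤 : Quaternion
  𝐢 = quat K.0# K.1# K.0# K.0#
  𝐣 = quat K.0# K.0# K.1# K.0#
  𝐤 = quat K.0# K.0# K.0# K.1#

  conj : Quaternion → Quaternion
  conj (quat a b c d) = quat a (K.- b) (K.- c) (K.- d)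

  N : Quaternion → Quaternion
  N q = q * conj q

open ℍ-Ops using (scalar; 𝐢; 𝐣; 𝐤; conj; N) public

quat-elim : ∀ {p} (P : Quaternion → Set p) → (∀ a b c d → P (quat a b c d)) → ∀ q → P q
quat-elim P P-quat (quat a b c d) = P-quat a b c d

quat-cong : ∀ {a a′ b b′ c c′ d d′} → a ≡ a′ → b ≡ b′ → c ≡ c′ → d ≡ d′ →
            quat a b c d ≡ quat a′ b′ c′ d′
quat-cong refl refl refl refl = refl

module ℍ-Coordinates where
  open ℚ√2-Solver public
  module K = CommutativeRing ℚ√2-commutativeRing

  module Coordinates {A : Set} (_+_ _-_ _*_ : A → A → A) where
    re im jm km : (a b c d e f g h : A) → A
    re a b c d e f g h = (((a * e) - (b * f)) - (c * g)) - (d * h)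
    im a b c d e f g h = (((a * f) + (b * e)) + (c * h)) - (d * g)
    jm a b c d e f g h = (((a * g) - (b * h)) + (c * e)) + (d * f)
    km a b c d e f g h = (((a * h) + (b * g)) - (c * f)) + (d * e)

  module C = Coordinates K._+_ K._-_ K._*_
  open module P {n} = Coordinates {Polynomial n} _:+_ _:-_ _:*_ public

  one nil : ∀ {n} → Polynomial n
  one = con 1ℤ
  nil = con 0ℤ

  assoc-re : ∀ a b c d e f g h i j k l →
    C.re (C.re a b c d e f g h) (C.im a b c d e f g h)
      (C.jm a b c d e f g h) (C.km a b c d e f g h) i j k l
    ≡ C.re a b c d (C.re e f g h i j k l) (C.im e f g h i j k l)
      (C.jm e f g h i j k l) (C.km e f g h i j k l)
  assoc-re = solve 12 (λ a b c d e f g h i j k l →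
    re (re a b c d e f g h) (im a b c d e f g h)
      (jm a b c d e f g h) (km a b c d e f g h) i j k l
    := re a b c d (re e f g h i j k l) (im e f g h i j k l)
      (jm e f g h i j k l) (km e f g h i j k l)) refl

  assoc-im : ∀ a b c d e f g h i j k l →
    C.im (C.re a b c d e f g h) (C.im a b c d e f g h)
      (C.jm a b c d e f g h) (C.km a b c d e f g h) i j k l
    ≡ C.im a b c d (C.re e f g h i j k l) (C.im e f g h i j k l)
      (C.jm e f g h i j k l) (C.km e f g h i j k l)
  assoc-im = solve 12 (λ a b c d e f g h i j k l →
    im (re a b c d e f g h) (im a b c d e f g h)
      (jm a b c d e f g h) (km a b c d e f g h) i j k l
    := im a b c d (re e f g h i j k l) (im e f g h i j k l)
      (jm e f g h i j k l) (km e f g h i j k l)) refl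

  assoc-jm : ∀ a b c d e f g h i j k l →
    C.jm (C.re a b c d e f g h) (C.im a b c d e f g h)
      (C.jm a b c d e f g h) (C.km a b c d e f g h) i j k l
    ≡ C.jm a b c d (C.re e f g h i j k l) (C.im e f g h i j k l)
      (C.jm e f g h i j k l) (C.km e f g h i j k l)
  assoc-jm = solve 12 (λ a b c d e f g h i j k l →
    jm (re a b c d e f g h) (im a b c d e f g h)
      (jm a b c d e f g h) (km a b c d e f g h) i j k l
    := jm a b c d (re e f g h i j k l) (im e f g h i j k l)
      (jm e f g h i j k l) (km e f g h i j k l)) refl

  assoc-km : ∀ a b c d e f g h i j k l →
    C.km (C.re a b c d e f g h) (C.im a b c d e f g h)
      (C.jm a b c d e f g h) (C.km a b c d e f g h) i j k l
    ≡ C.km a b c d (C.re e f g h i j k l) (C.im e f g h i j k l)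
      (C.jm e f g h i j k l) (C.km e f g h i j k l)
  assoc-km = solve 12 (λ a b c d e f g h i j k l →
    km (re a b c d e f g h) (im a b c d e f g h)
      (jm a b c d e f g h) (km a b c d e f g h) i j k l
    := km a b c d (re e f g h i j k l) (im e f g h i j k l)
      (jm e f g h i j k l) (km e f g h i j k l)) refl

  *-assoc-coordinates : ∀ a b c d e f g h i j k l →
    quat (C.re (C.re a b c d e f g h) (C.im a b c d e f g h)
               (C.jm a b c d e f g h) (C.km a b c d e f g h) i j k l)
         (C.im (C.re a b c d e f g h) (C.im a b c d e f g h)
               (C.jm a b c d e f g h) (C.km a b c d e f g h) i j k l)
         (C.jm (C.re a b c d e f g h) (C.im a b c d e f g h)
               (C.jm a b c d e f g h) (C.km a b c d e f g h) i j k l)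
         (C.km (C.re a b c d e f g h) (C.im a b c d e f g h)
               (C.jm a b c d e f g h) (C.km a b c d e f g h) i j k l)
    ≡
    quat (C.re a b c d (C.re e f g h i j k l) (C.im e f g h i j k l)
               (C.jm e f g h i j k l) (C.km e f g h i j k l))
         (C.im a b c d (C.re e f g h i j k l) (C.im e f g h i j k l)
               (C.jm e f g h i j k l) (C.km e f g h i j k l))
         (C.jm a b c d (C.re e f g h i j k l) (C.im e f g h i j k l)
               (C.jm e f g h i j k l) (C.km e f g h i j k l))
         (C.km a b c d (C.re e f g h i j k l) (C.im e f g h i j k l)
               (C.jm e f g h i j k l) (C.km e f g h i j k l))
  *-assoc-coordinates a b c d e f g h i j k l = quat-cong
    (assoc-re a b c d e f g h i j k l) (assoc-im a b c d e f g h i j k l)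
    (assoc-jm a b c d e f g h i j k l) (assoc-km a b c d e f g h i j k l)

  *-assoc-quat : ∀ a b c d e f g h i j k l →
    (quat a b c d ℍ-Ops.* quat e f g h) ℍ-Ops.* quat i j k l ≡
    quat a b c d ℍ-Ops.* (quat e f g h ℍ-Ops.* quat i j k l)
  *-assoc-quat a b c d e f g h i j k l =
    *-assoc-coordinates a b c d e f g h i j k l

  -- Matching on p, q and r directly makes this take minutes to check.
  *-assoc : ∀ p q r → (p ℍ-Ops.* q) ℍ-Ops.* r ≡ p ℍ-Ops.* (q ℍ-Ops.* r)
  *-assoc = quat-elim (λ p → ∀ q r → (p * q) * r ≡ p * (q * r))
    λ a b c d → quat-elim (λ q → ∀ r → (quat a b c d * q) * r ≡ quat a b c d * (q * r))
    λ e f g h → quat-elim (λ r → (quat a b c d * quat e f g h) * r ≡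
                                 quat a b c d * (quat e f g h * r))
    λ i j k l → *-assoc-quat a b c d e f g h i j k l
    where open ℍ-Ops

ℍ-ring : Ring 0ℓ 0ℓ
ℍ-ring = record
  { Carrier = Quaternion ; _≈_ = _≡_ ; _+_ = _+_ ; _*_ = _*_ ; -_ = -_
  ; 0# = scalar K.0# ; 1# = scalar K.1#
  ; isRing = record
    { +-isAbelianGroup = record
      { isGroup = record
        { isMonoid = record
          { isSemigroup = record
            { isMagma = record { isEquivalence = isEquivalence ; ∙-cong = cong₂ _+_ }
            ; assoc = λ { (quat a b c d) (quat e f g h) (quat i j k l) → quat-cong
                (K.+-assoc a e i) (K.+-assoc b f j) (K.+-assoc c g k) (K.+-assoc d h l) }
            }
          ; identity =
              (λ { (quat a b c d) → quat-cong
                (K.+-identityˡ a) (K.+-identityˡ b) (K.+-identityˡ c) (K.+-identityˡ d) })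
            , (λ { (quat a b c d) → quat-cong
                (K.+-identityʳ a) (K.+-identityʳ b) (K.+-identityʳ c) (K.+-identityʳ d) })
          }
        ; inverse =
            (λ { (quat a b c d) → quat-cong
              (K.-‿inverseˡ a) (K.-‿inverseˡ b) (K.-‿inverseˡ c) (K.-‿inverseˡ d) })
          , (λ { (quat a b c d) → quat-cong
              (K.-‿inverseʳ a) (K.-‿inverseʳ b) (K.-‿inverseʳ c) (K.-‿inverseʳ d) })
        ; ⁻¹-cong = cong -_
        }
      ; comm = λ { (quat a b c d) (quat e f g h) → quat-cong
          (K.+-comm a e) (K.+-comm b f) (K.+-comm c g) (K.+-comm d h) }
      }
    ; *-cong = cong₂ _*_
    ; *-assoc = *-assoc
    ; *-identity =
        (λ { (quat a b c d) → quat-cong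
          (solve 4 (λ a b c d → re one nil nil nil a b c d := a) refl a b c d)
          (solve 4 (λ a b c d → im one nil nil nil a b c d := b) refl a b c d)
          (solve 4 (λ a b c d → jm one nil nil nil a b c d := c) refl a b c d)
          (solve 4 (λ a b c d → km one nil nil nil a b c d := d) refl a b c d) })
      , (λ { (quat a b c d) → quat-cong
          (solve 4 (λ a b c d → re a b c d one nil nil nil := a) refl a b c d)
          (solve 4 (λ a b c d → im a b c d one nil nil nil := b) refl a b c d)
          (solve 4 (λ a b c d → jm a b c d one nil nil nil := c) refl a b c d)
          (solve 4 (λ a b c d → km a b c d one nil nil nil := d) refl a b c d) })
    ; distrib =
        (λ { (quat a b c d) (quat e f g h) (quat i j k l) → quat-cong
          (solve 12 (λ a b c d e f g h i j k l →
             re a b c d (e :+ i) (f :+ j) (g :+ k) (h :+ l)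
             := re a b c d e f g h :+ re a b c d i j k l) refl a b c d e f g h i j k l)
          (solve 12 (λ a b c d e f g h i j k l →
             im a b c d (e :+ i) (f :+ j) (g :+ k) (h :+ l)
             := im a b c d e f g h :+ im a b c d i j k l) refl a b c d e f g h i j k l)
          (solve 12 (λ a b c d e f g h i j k l →
             jm a b c d (e :+ i) (f :+ j) (g :+ k) (h :+ l)
             := jm a b c d e f g h :+ jm a b c d i j k l) refl a b c d e f g h i j k l)
          (solve 12 (λ a b c d e f g h i j k l →
             km a b c d (e :+ i) (f :+ j) (g :+ k) (h :+ l)
             := km a b c d e f g h :+ km a b c d i j k l) refl a b c d e f g h i j k l) })
      , (λ { (quat a b c d) (quat e f g h) (quat i j k l) → quat-cong
          (solve 12 (λ a b c d e f g h i j k l →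
             re (e :+ i) (f :+ j) (g :+ k) (h :+ l) a b c d
             := re e f g h a b c d :+ re i j k l a b c d) refl a b c d e f g h i j k l)
          (solve 12 (λ a b c d e f g h i j k l →
             im (e :+ i) (f :+ j) (g :+ k) (h :+ l) a b c d
             := im e f g h a b c d :+ im i j k l a b c d) refl a b c d e f g h i j k l)
          (solve 12 (λ a b c d e f g h i j k l →
             jm (e :+ i) (f :+ j) (g :+ k) (h :+ l) a b c d
             := jm e f g h a b c d :+ jm i j k l a b c d) refl a b c d e f g h i j k l)
          (solve 12 (λ a b c d e f g h i j k l →
             km (e :+ i) (f :+ j) (g :+ k) (h :+ l) a b c d
             := km e f g h a b c d :+ km i j k l a b c d) refl a b c d e f g h i j k l) })
    }
  }
  where
  open ℍ-Ops
  open ℍ-Coordinates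

module ℍ = Ring ℍ-ring

ι : ℤ → Quaternion
ι n = scalar (ℤ→ℚ√2 n)

ι-homo-+ : ∀ m n → ι (m ℤ.+ n) ≡ ι m ℍ.+ ι n
ι-homo-+ m n = cong scalar (ℤ→ℚ√2-homo-+ m n)

scalar-homo-* : ∀ a b → scalar (a ℚ√2-Ops.* b) ≡ scalar a ℍ.* scalar b
scalar-homo-* a b = quat-cong
  (solve 2 (λ a b → a :* b := a :* b :- z :* z :- z :* z :- z :* z) refl a b)
  (solve 2 (λ a b → z := a :* z :+ z :* b :+ z :* z :- z :* z) refl a b)
  (solve 2 (λ a b → z := a :* z :- z :* z :+ z :* b :+ z :* z) refl a b)
  (solve 2 (λ a b → z := a :* z :+ z :* z :- z :* z :+ z :* b) refl a b)
  where
  open ℚ√2-Solver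
  z : ∀ {n} → Polynomial n
  z = con 0ℤ

ι-homo-* : ∀ m n → ι (m ℤ.* n) ≡ ι m ℍ.* ι n
ι-homo-* m n = trans (cong scalar (ℤ→ℚ√2-homo-* m n)) (scalar-homo-* (ℤ→ℚ√2 m) (ℤ→ℚ√2 n))

scalar-central : ∀ a q → scalar a ℍ.* q ≡ q ℍ.* scalar a
scalar-central a (quat e f g h) = quat-cong
  (solve 5 (λ a e f g h → a :* e :- z :* f :- z :* g :- z :* h
    := e :* a :- f :* z :- g :* z :- h :* z) refl a e f g h)
  (solve 5 (λ a e f g h → a :* f :+ z :* e :+ z :* h :- z :* g
    := e :* z :+ f :* a :+ g :* z :- h :* z) refl a e f g h)
  (solve 5 (λ a e f g h → a :* g :- z :* h :+ z :* e :+ z :* f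
    := e :* z :- f :* z :+ g :* a :+ h :* z) refl a e f g h)
  (solve 5 (λ a e f g h → a :* h :+ z :* g :- z :* f :+ z :* e
    := e :* z :+ f :* z :- g :* z :+ h :* a) refl a e f g h)
  where
  open ℚ√2-Solver
  z : ∀ {n} → Polynomial n
  z = con 0ℤ

½K : ℚ√2
½K = ½ +√2 0ℚ

v : Fin 4 → Quaternion
v 0F = ℍ.1#
v 1F = 𝐢
v 2F = scalar ½K ℍ.* (ℍ.1# ℍ.+ 𝐢 ℍ.+ scalar √2 ℍ.* 𝐣)
v 3F = scalar ½K ℍ.* (ℍ.1# ℍ.+ 𝐢 ℍ.+ scalar √2 ℍ.* 𝐤)

open SemiringSum ℍ.semiring
  using (sum; sum-syntax; sum-cong-≋; ∑-distrib-+; *-distribˡ-sum; *-distribʳ-sum)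

infix 4 _∈H₁₂₂

_∈H₁₂₂ : Quaternion → Set
q ∈H₁₂₂ = ∃ λ (c : Vector ℤ 4) → q ≡ ∑[ i < 4 ] (ι (c i) ℍ.* v i)

+-closed : ∀ {p q} → p ∈H₁₂₂ → q ∈H₁₂₂ → p ℍ.+ q ∈H₁₂₂
+-closed (c , refl) (d , refl) = (λ i → c i ℤ.+ d i) , (begin
  (∑[ i < 4 ] (ι (c i) ℍ.* v i)) ℍ.+ (∑[ i < 4 ] (ι (d i) ℍ.* v i))
    ≡⟨ ∑-distrib-+ (λ i → ι (c i) ℍ.* v i) (λ i → ι (d i) ℍ.* v i) ⟨
  ∑[ i < 4 ] (ι (c i) ℍ.* v i ℍ.+ ι (d i) ℍ.* v i)
    ≡⟨ sum-cong-≋ (λ i → trans (sym (ℍ.distribʳ (v i) (ι (c i)) (ι (d i))))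
                               (cong (ℍ._* v i) (sym (ι-homo-+ (c i) (d i))))) ⟩
  ∑[ i < 4 ] (ι (c i ℤ.+ d i) ℍ.* v i) ∎)
  where open ≡-Reasoning

ι*-closed : ∀ n {q} → q ∈H₁₂₂ → ι n ℍ.* q ∈H₁₂₂
ι*-closed n (c , refl) = (λ i → n ℤ.* c i) , (begin
  ι n ℍ.* (∑[ i < 4 ] (ι (c i) ℍ.* v i))
    ≡⟨ *-distribˡ-sum (ι n) (λ i → ι (c i) ℍ.* v i) ⟩
  ∑[ i < 4 ] (ι n ℍ.* (ι (c i) ℍ.* v i))
    ≡⟨ sum-cong-≋ (λ i → trans (sym (ℍ.*-assoc (ι n) (ι (c i)) (v i)))
                               (cong (ℍ._* v i) (sym (ι-homo-* n (c i))))) ⟩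
  ∑[ i < 4 ] (ι (n ℤ.* c i) ℍ.* v i) ∎)
  where open ≡-Reasoning

0-closed : ℍ.0# ∈H₁₂₂
0-closed = (λ _ → 0ℤ) , refl

1-closed : ℍ.1# ∈H₁₂₂
1-closed = 1ℤ ∷ 0ℤ ∷ 0ℤ ∷ 0ℤ ∷ [] , refl

-‿closed : ∀ {q} → q ∈H₁₂₂ → ℍ.- q ∈H₁₂₂
-‿closed {q} q∈H = subst _∈H₁₂₂ (-1*x≈-x q) (ι*-closed -1ℤ q∈H)
  where open RingProperties ℍ-ring using (-1*x≈-x)

∑-closed : ∀ {n} (f : Vector Quaternion n) → (∀ i → f i ∈H₁₂₂) → sum f ∈H₁₂₂
∑-closed {zero}  f f∈H = 0-closed
∑-closed {suc n} f f∈H =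
  +-closed (f∈H Fin.zero) (∑-closed (λ i → f (Fin.suc i)) (λ i → f∈H (Fin.suc i)))

-- The generators with their coordinates multiplied out, which makes the
-- multiplication table computable in reasonable time.
v′ : Fin 4 → Quaternion
v′ 0F = quat (1ℚ +√2 0ℚ) (0ℚ +√2 0ℚ) (0ℚ +√2 0ℚ) (0ℚ +√2 0ℚ)
v′ 1F = quat (0ℚ +√2 0ℚ) (1ℚ +√2 0ℚ) (0ℚ +√2 0ℚ) (0ℚ +√2 0ℚ)
v′ 2F = quat (½  +√2 0ℚ) (½  +√2 0ℚ) (0ℚ +√2 ½ ) (0ℚ +√2 0ℚ)
v′ 3F = quat (½  +√2 0ℚ) (½  +√2 0ℚ) (0ℚ +√2 0ℚ) (0ℚ +√2 ½ )

v≡v′ : ∀ i → v i ≡ v′ i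
v≡v′ 0F = refl
v≡v′ 1F = refl
v≡v′ 2F = refl
v≡v′ 3F = refl

v*v-coefficients : Fin 4 → Fin 4 → Vector ℤ 4
v*v-coefficients 0F 0F = 1ℤ  ∷ 0ℤ  ∷ 0ℤ  ∷ 0ℤ  ∷ []
v*v-coefficients 0F 1F = 0ℤ  ∷ 1ℤ  ∷ 0ℤ  ∷ 0ℤ  ∷ []
v*v-coefficients 0F 2F = 0ℤ  ∷ 0ℤ  ∷ 1ℤ  ∷ 0ℤ  ∷ []
v*v-coefficients 0F 3F = 0ℤ  ∷ 0ℤ  ∷ 0ℤ  ∷ 1ℤ  ∷ []
v*v-coefficients 1F 0F = 0ℤ  ∷ 1ℤ  ∷ 0ℤ  ∷ 0ℤ  ∷ []
v*v-coefficients 1F 1F = -1ℤ ∷ 0ℤ  ∷ 0ℤ  ∷ 0ℤ  ∷ []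
v*v-coefficients 1F 2F = -1ℤ ∷ 0ℤ  ∷ 0ℤ  ∷ 1ℤ  ∷ []
v*v-coefficients 1F 3F = 0ℤ  ∷ 1ℤ  ∷ -1ℤ ∷ 0ℤ  ∷ []
v*v-coefficients 2F 0F = 0ℤ  ∷ 0ℤ  ∷ 1ℤ  ∷ 0ℤ  ∷ []
v*v-coefficients 2F 1F = 0ℤ  ∷ 1ℤ  ∷ 0ℤ  ∷ -1ℤ ∷ []
v*v-coefficients 2F 2F = -1ℤ ∷ 0ℤ  ∷ 1ℤ  ∷ 0ℤ  ∷ []
v*v-coefficients 2F 3F = 0ℤ  ∷ 1ℤ  ∷ 0ℤ  ∷ 0ℤ  ∷ []
v*v-coefficients 3F 0F = 0ℤ  ∷ 0ℤ  ∷ 0ℤ  ∷ 1ℤ  ∷ []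
v*v-coefficients 3F 1F = -1ℤ ∷ 0ℤ  ∷ 1ℤ  ∷ 0ℤ  ∷ []
v*v-coefficients 3F 2F = -1ℤ ∷ -1ℤ ∷ 1ℤ  ∷ 1ℤ  ∷ []
v*v-coefficients 3F 3F = -1ℤ ∷ 0ℤ  ∷ 0ℤ  ∷ 1ℤ  ∷ []

v′*v′ : ∀ i j → v′ i ℍ.* v′ j ≡ ∑[ k < 4 ] (ι (v*v-coefficients i j k) ℍ.* v′ k)
v′*v′ 0F 0F = refl
v′*v′ 0F 1F = refl
v′*v′ 0F 2F = refl
v′*v′ 0F 3F = refl
v′*v′ 1F 0F = refl
v′*v′ 1F 1F = refl
v′*v′ 1F 2F = refl
v′*v′ 1F 3F = refl
v′*v′ 2F 0F = refl
v′*v′ 2F 1F = refl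
v′*v′ 2F 2F = refl
v′*v′ 2F 3F = refl
v′*v′ 3F 0F = refl
v′*v′ 3F 1F = refl
v′*v′ 3F 2F = refl
v′*v′ 3F 3F = refl

v*v : ∀ i j → v i ℍ.* v j ∈H₁₂₂
v*v i j = v*v-coefficients i j , (begin
  v i ℍ.* v j                                        ≡⟨ cong₂ ℍ._*_ (v≡v′ i) (v≡v′ j) ⟩
  v′ i ℍ.* v′ j                                      ≡⟨ v′*v′ i j ⟩
  ∑[ k < 4 ] (ι (v*v-coefficients i j k) ℍ.* v′ k)
    ≡⟨ sum-cong-≋ (λ k → cong (ι (v*v-coefficients i j k) ℍ.*_) (v≡v′ k)) ⟨
  ∑[ k < 4 ] (ι (v*v-coefficients i j k) ℍ.* v k)    ∎)
  where open ≡-Reasoning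

*-closed : ∀ {p q} → p ∈H₁₂₂ → q ∈H₁₂₂ → p ℍ.* q ∈H₁₂₂
*-closed {q = q} (c , refl) (d , refl) =
  subst _∈H₁₂₂ (sym (*-distribʳ-sum q (λ i → ι (c i) ℍ.* v i)))
    (∑-closed (λ i → ι (c i) ℍ.* v i ℍ.* q) λ i →
      subst _∈H₁₂₂ (sym (ℍ.*-assoc (ι (c i)) (v i) q)) (ι*-closed (c i) (v*q i)))
  where
  open ≡-Reasoning

  swap : ∀ i j → ι (d j) ℍ.* (v i ℍ.* v j) ≡ v i ℍ.* (ι (d j) ℍ.* v j)
  swap i j = begin
    ι (d j) ℍ.* (v i ℍ.* v j)  ≡⟨ ℍ.*-assoc (ι (d j)) (v i) (v j) ⟨
    ι (d j) ℍ.* v i ℍ.* v j    ≡⟨ cong (ℍ._* v j) (scalar-central (ℤ→ℚ√2 (d j)) (v i)) ⟩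
    v i ℍ.* ι (d j) ℍ.* v j    ≡⟨ ℍ.*-assoc (v i) (ι (d j)) (v j) ⟩
    v i ℍ.* (ι (d j) ℍ.* v j)  ∎

  v*q : ∀ i → v i ℍ.* q ∈H₁₂₂
  v*q i = subst _∈H₁₂₂ (sym (*-distribˡ-sum (v i) (λ j → ι (d j) ℍ.* v j)))
    (∑-closed (λ j → v i ℍ.* (ι (d j) ℍ.* v j)) λ j →
      subst _∈H₁₂₂ (swap i j) (ι*-closed (d j) (v*v i j)))

H₁₂₂ : Set
H₁₂₂ = ∃ _∈H₁₂₂

H₁₂₂-rawRing : RawRing 0ℓ 0ℓ
H₁₂₂-rawRing = record
  { Carrier = H₁₂₂
  ; _≈_     = λ p q → proj₁ p ≡ proj₁ q
  ; _+_     = λ { (p , p∈H) (q , q∈H) → p ℍ.+ q , +-closed p∈H q∈H }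
  ; _*_     = λ { (p , p∈H) (q , q∈H) → p ℍ.* q , *-closed p∈H q∈H }
  ; -_      = λ { (q , q∈H) → ℍ.- q , -‿closed q∈H }
  ; 0#      = ℍ.0# , 0-closed
  ; 1#      = ℍ.1# , 1-closed
  }

H₁₂₂-ring : Ring 0ℓ 0ℓ
H₁₂₂-ring = record
  { RawRing H₁₂₂-rawRing
  ; isRing = RingMonomorphism.isRing proj₁-isRingMonomorphism ℍ.isRing
  }
  where
  proj₁-isRingMonomorphism : IsRingMonomorphism H₁₂₂-rawRing ℍ.rawRing proj₁
  proj₁-isRingMonomorphism = record
    { isRingHomomorphism = record
      { isSemiringHomomorphism = record
        { isNearSemiringHomomorphism = record
          { +-isMonoidHomomorphism = record
            { isMagmaHomomorphism = record
              { isRelHomomorphism = record { cong = λ p≈q → p≈q }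
              ; homo = λ _ _ → refl
              }
            ; ε-homo = refl
            }
          ; *-homo = λ _ _ → refl
          }
        ; 1#-homo = refl
        }
      ; -‿homo = λ _ → refl
      }
    ; injective = λ p≈q → p≈q
    }

√2𝐣∈H₁₂₂ : scalar √2 ℍ.* 𝐣 ∈H₁₂₂
√2𝐣∈H₁₂₂ = -1ℤ ∷ -1ℤ ∷ + 2 ∷ 0ℤ ∷ [] , refl

√2𝐤∈H₁₂₂ : scalar √2 ℍ.* 𝐤 ∈H₁₂₂
√2𝐤∈H₁₂₂ = -1ℤ ∷ -1ℤ ∷ 0ℤ ∷ + 2 ∷ [] , refl

integral : (q₁ q₂ q₃ q₄ : ℤ) → H₁₂₂
integral q₁ q₂ q₃ q₄ =
    ι q₁ ℍ.* ℍ.1#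
    ℍ.+ ι q₂ ℍ.* 𝐢
    ℍ.+ ι q₃ ℍ.* (scalar √2 ℍ.* 𝐣)
    ℍ.+ ι q₄ ℍ.* (scalar √2 ℍ.* 𝐤)
  , +-closed (+-closed (+-closed
      (ι*-closed q₁ 1-closed)
      (ι*-closed q₂ (v*v 0F 1F)))
      (ι*-closed q₃ √2𝐣∈H₁₂₂))
      (ι*-closed q₄ √2𝐤∈H₁₂₂)

-- Quotients are setoid quotients: the carrier stays R, and x ≈ₘ y says
-- that x - y lies in the ideal mR.
module Quotient {c ℓ} (R : Ring c ℓ) (m : ℕ) where
  open Ring R renaming (refl to ≈-refl)
  open RingProperties R using (-1*x≈-x; -‿distribʳ-*; -‿distribˡ-*)
  open AbelianGroupProperties +-abelianGroup using (⁻¹-anti-homo‿-; ⁻¹-∙-comm)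
  open Mult +-commutativeMonoid using (×-distrib-+; ×-congʳ) renaming (_×_ to _·_)
  open SemiringMult semiring using (×-comm-*; ×-assoc-*)
  open import Relation.Binary.Reasoning.Setoid setoid
  open import Algebra.Properties.CommutativeSemigroup +-commutativeSemigroup using (interchange)

  infix 4 _≈ₘ_

  _≈ₘ_ : Carrier → Carrier → Set (c ⊔ ℓ)
  x ≈ₘ y = ∃ λ z → x - y ≈ m · z

  m·0≈0 : m · 0# ≈ 0#
  m·0≈0 = begin
    m · 0#         ≈⟨ ×-congʳ m (zeroˡ 0#) ⟨
    m · (0# * 0#)  ≈⟨ ×-comm-* m 0# 0# ⟨
    0# * (m · 0#)  ≈⟨ zeroˡ (m · 0#) ⟩
    0#             ∎

  m·-z : ∀ z → - (m · z) ≈ m · (- z)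
  m·-z z = begin
    - (m · z)         ≈⟨ -1*x≈-x (m · z) ⟨
    - 1# * (m · z)    ≈⟨ ×-comm-* m (- 1#) z ⟩
    m · (- 1# * z)    ≈⟨ ×-congʳ m (-1*x≈-x z) ⟩
    m · (- z)         ∎

  telescope : ∀ x y z → x - z ≈ (x - y) + (y - z)
  telescope x y z = begin
    x - z                ≈⟨ +-congˡ (+-identityˡ (- z)) ⟨
    x + (0# - z)         ≈⟨ +-congˡ (+-congʳ (-‿inverseˡ y)) ⟨
    x + (- y + y - z)    ≈⟨ +-congˡ (+-assoc (- y) y (- z)) ⟩
    x + (- y + (y - z))  ≈⟨ +-assoc x (- y) (y - z) ⟨
    (x - y) + (y - z)    ∎

  ≈⇒≈ₘ : ∀ {x y} → x ≈ y → x ≈ₘ y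
  ≈⇒≈ₘ {x} {y} x≈y = 0# , (begin
    x - y   ≈⟨ +-congʳ x≈y ⟩
    y - y   ≈⟨ -‿inverseʳ y ⟩
    0#      ≈⟨ m·0≈0 ⟨
    m · 0#  ∎)

  ≈ₘ-sym : ∀ {x y} → x ≈ₘ y → y ≈ₘ x
  ≈ₘ-sym {x} {y} (z , x-y≈mz) = - z , (begin
    y - x      ≈⟨ ⁻¹-anti-homo‿- x y ⟨
    - (x - y)  ≈⟨ -‿cong x-y≈mz ⟩
    - (m · z)  ≈⟨ m·-z z ⟩
    m · (- z)  ∎)

  ≈ₘ-trans : ∀ {x y z} → x ≈ₘ y → y ≈ₘ z → x ≈ₘ z
  ≈ₘ-trans {x} {y} {z} (s , x-y≈ms) (t , y-z≈mt) = s + t , (begin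
    x - z              ≈⟨ telescope x y z ⟩
    (x - y) + (y - z)  ≈⟨ +-cong x-y≈ms y-z≈mt ⟩
    m · s + m · t      ≈⟨ ×-distrib-+ s t m ⟨
    m · (s + t)        ∎)

  ≈ₘ-+-cong : ∀ {x x′ y y′} → x ≈ₘ x′ → y ≈ₘ y′ → x + y ≈ₘ x′ + y′
  ≈ₘ-+-cong {x} {x′} {y} {y′} (s , x-x′≈ms) (t , y-y′≈mt) = s + t , (begin
    x + y - (x′ + y′)        ≈⟨ +-congˡ (⁻¹-∙-comm x′ y′) ⟨
    x + y + (- x′ + - y′)    ≈⟨ interchange x y (- x′) (- y′) ⟩
    (x - x′) + (y - y′)      ≈⟨ +-cong x-x′≈ms y-y′≈mt ⟩
    m · s + m · t            ≈⟨ ×-distrib-+ s t m ⟨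
    m · (s + t)              ∎)

  ≈ₘ-*-cong : ∀ {x x′ y y′} → x ≈ₘ x′ → y ≈ₘ y′ → x * y ≈ₘ x′ * y′
  ≈ₘ-*-cong {x} {x′} {y} {y′} (s , x-x′≈ms) (t , y-y′≈mt) = s * y + x′ * t , (begin
    x * y - x′ * y′                        ≈⟨ telescope (x * y) (x′ * y) (x′ * y′) ⟩
    (x * y - x′ * y) + (x′ * y - x′ * y′)  ≈⟨ +-cong (+-congˡ (-‿distribˡ-* x′ y)) (+-congˡ (-‿distribʳ-* x′ y′)) ⟩
    (x * y + - x′ * y) + (x′ * y + x′ * - y′)
                                           ≈⟨ +-cong (distribʳ y x (- x′)) (distribˡ x′ y (- y′)) ⟨
    (x - x′) * y + x′ * (y - y′)           ≈⟨ +-cong (*-congʳ x-x′≈ms) (*-congˡ y-y′≈mt) ⟩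
    (m · s) * y + x′ * (m · t)             ≈⟨ +-cong (×-assoc-* m s y) (×-comm-* m x′ t) ⟩
    m · (s * y) + m · (x′ * t)             ≈⟨ ×-distrib-+ (s * y) (x′ * t) m ⟨
    m · (s * y + x′ * t)                   ∎)

  ≈ₘ-‿cong : ∀ {x x′} → x ≈ₘ x′ → - x ≈ₘ - x′
  ≈ₘ-‿cong {x} {x′} (s , x-x′≈ms) = - s , (begin
    - x - - x′  ≈⟨ ⁻¹-∙-comm x (- x′) ⟩
    - (x - x′)  ≈⟨ -‿cong x-x′≈ms ⟩
    - (m · s)   ≈⟨ m·-z s ⟩
    m · (- s)   ∎)

  quotientRing : Ring c (c ⊔ ℓ)
  quotientRing = record
    { _≈_ = _≈ₘ_ ; _+_ = _+_ ; _*_ = _*_ ; -_ = -_ ; 0# = 0# ; 1# = 1#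
    ; isRing = record
      { +-isAbelianGroup = record
        { isGroup = record
          { isMonoid = record
            { isSemigroup = record
              { isMagma = record
                { isEquivalence = record
                  { refl = ≈⇒≈ₘ ≈-refl ; sym = ≈ₘ-sym ; trans = ≈ₘ-trans }
                ; ∙-cong = ≈ₘ-+-cong
                }
              ; assoc = λ x y z → ≈⇒≈ₘ (+-assoc x y z)
              }
            ; identity = (λ x → ≈⇒≈ₘ (+-identityˡ x)) , (λ x → ≈⇒≈ₘ (+-identityʳ x))
            }
          ; inverse = (λ x → ≈⇒≈ₘ (-‿inverseˡ x)) , (λ x → ≈⇒≈ₘ (-‿inverseʳ x))
          ; ⁻¹-cong = ≈ₘ-‿cong
          }
        ; comm = λ x y → ≈⇒≈ₘ (+-comm x y)
        }
      ; *-cong = ≈ₘ-*-cong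
      ; *-assoc = λ x y z → ≈⇒≈ₘ (*-assoc x y z)
      ; *-identity = (λ x → ≈⇒≈ₘ (*-identityˡ x)) , (λ x → ≈⇒≈ₘ (*-identityʳ x))
      ; distrib = (λ x y z → ≈⇒≈ₘ (distribˡ x y z)) , (λ x y z → ≈⇒≈ₘ (distribʳ x y z))
      }
    }

infix 8 H₁₂₂/_ ℤ/_

H₁₂₂/_ : ℕ → Ring 0ℓ 0ℓ
H₁₂₂/ m = Quotient.quotientRing H₁₂₂-ring m

ℤ/_ : ℕ → CommutativeRing 0ℓ 0ℓ
ℤ/ m = record
  { isCommutativeRing = record
    { isRing = Ring.isRing quotientRing
    ; *-comm = λ x y → ≈⇒≈ₘ (ℤ.*-comm x y)
    }
  }
  where open Quotient ℤ.+-*-ring m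

record Matrix₂ {a} (A : Set a) : Set a where
  constructor mat
  field
    e₁₁ e₁₂ e₂₁ e₂₂ : A

module _ {c ℓ} (R : CommutativeRing c ℓ) where
  open CommutativeRing R renaming (refl to ≈-refl; sym to ≈-sym; trans to ≈-trans)

  record _≈M_ (x y : Matrix₂ Carrier) : Set ℓ where
    constructor mat≈
    private
      module x = Matrix₂ x
      module y = Matrix₂ y
    field
      e₁₁ : x.e₁₁ ≈ y.e₁₁
      e₁₂ : x.e₁₂ ≈ y.e₁₂
      e₂₁ : x.e₂₁ ≈ y.e₂₁
      e₂₂ : x.e₂₂ ≈ y.e₂₂

  det : Matrix₂ Carrier → Carrier
  det (mat a b c d) = a * d - b * c

  M₂ : Ring c ℓ
  M₂ = record
    { Carrier = Matrix₂ Carrier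
    ; _≈_ = _≈M_
    ; _+_ = λ { (mat a b c d) (mat e f g h) → mat (a + e) (b + f) (c + g) (d + h) }
    ; _*_ = λ { (mat a b c d) (mat e f g h) →
        mat (a * e + b * g) (a * f + b * h) (c * e + d * g) (c * f + d * h) }
    ; -_ = λ { (mat a b c d) → mat (- a) (- b) (- c) (- d) }
    ; 0# = mat 0# 0# 0# 0#
    ; 1# = mat 1# 0# 0# 1#
    ; isRing = record
      { +-isAbelianGroup = record
        { isGroup = record
          { isMonoid = record
            { isSemigroup = record
              { isMagma = record
                { isEquivalence = record
                  { refl = mat≈ ≈-refl ≈-refl ≈-refl ≈-refl
                  ; sym = λ { (mat≈ p q r s) → mat≈ (≈-sym p) (≈-sym q) (≈-sym r) (≈-sym s) }
                  ; trans = λ { (mat≈ p q r s) (mat≈ p′ q′ r′ s′) →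
                      mat≈ (≈-trans p p′) (≈-trans q q′) (≈-trans r r′) (≈-trans s s′) }
                  }
                ; ∙-cong = λ { (mat≈ p q r s) (mat≈ p′ q′ r′ s′) →
                    mat≈ (+-cong p p′) (+-cong q q′) (+-cong r r′) (+-cong s s′) }
                }
              ; assoc = λ _ _ _ →
                  mat≈ (+-assoc _ _ _) (+-assoc _ _ _) (+-assoc _ _ _) (+-assoc _ _ _)
              }
            ; identity =
                (λ _ → mat≈ (+-identityˡ _) (+-identityˡ _) (+-identityˡ _) (+-identityˡ _))
              , (λ _ → mat≈ (+-identityʳ _) (+-identityʳ _) (+-identityʳ _) (+-identityʳ _))
            }
          ; inverse =
              (λ _ → mat≈ (-‿inverseˡ _) (-‿inverseˡ _) (-‿inverseˡ _) (-‿inverseˡ _))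
            , (λ _ → mat≈ (-‿inverseʳ _) (-‿inverseʳ _) (-‿inverseʳ _) (-‿inverseʳ _))
          ; ⁻¹-cong = λ { (mat≈ p q r s) →
              mat≈ (-‿cong p) (-‿cong q) (-‿cong r) (-‿cong s) }
          }
        ; comm = λ _ _ → mat≈ (+-comm _ _) (+-comm _ _) (+-comm _ _) (+-comm _ _)
        }
      ; *-cong = λ { (mat≈ p q r s) (mat≈ p′ q′ r′ s′) → mat≈
          (+-cong (*-cong p p′) (*-cong q r′)) (+-cong (*-cong p q′) (*-cong q s′))
          (+-cong (*-cong r p′) (*-cong s r′)) (+-cong (*-cong r q′) (*-cong s s′)) }
      ; *-assoc = λ { (mat a b c d) (mat e f g h) (mat i j k l) → mat≈
          (assoc₂ a b e f g h i k) (assoc₂ a b e f g h j l)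
          (assoc₂ c d e f g h i k) (assoc₂ c d e f g h j l) }
      ; *-identity =
          (λ { (mat a b c d) → mat≈ (1x+0y a c) (1x+0y b d) (0x+1y a c) (0x+1y b d) })
        , (λ { (mat a b c d) → mat≈ (x1+y0 a b) (x0+y1 a b) (x1+y0 c d) (x0+y1 c d) })
      ; distrib =
          (λ { (mat a b c d) (mat e f g h) (mat i j k l) → mat≈
            (distribˡ₂ a b e i g k) (distribˡ₂ a b f j h l)
            (distribˡ₂ c d e i g k) (distribˡ₂ c d f j h l) })
        , (λ { (mat a b c d) (mat e f g h) (mat i j k l) → mat≈
            (distribʳ₂ a c e i f j) (distribʳ₂ b d e i f j)
            (distribʳ₂ a c g k h l) (distribʳ₂ b d g k h l) })
      }
    }
    where
    open SemiringSolver commutativeSemiring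

    assoc₂ : ∀ a b e f g h i k →
      (a * e + b * g) * i + (a * f + b * h) * k ≈ a * (e * i + f * k) + b * (g * i + h * k)
    assoc₂ = solve 8 (λ a b e f g h i k →
      (a :* e :+ b :* g) :* i :+ (a :* f :+ b :* h) :* k
      := a :* (e :* i :+ f :* k) :+ b :* (g :* i :+ h :* k)) ≈-refl

    distribˡ₂ : ∀ a b e i g k → a * (e + i) + b * (g + k) ≈ (a * e + b * g) + (a * i + b * k)
    distribˡ₂ = solve 6 (λ a b e i g k →
      a :* (e :+ i) :+ b :* (g :+ k) := (a :* e :+ b :* g) :+ (a :* i :+ b :* k)) ≈-refl

    distribʳ₂ : ∀ a c e i f j → (e + i) * a + (f + j) * c ≈ (e * a + f * c) + (i * a + j * c)
    distribʳ₂ = solve 6 (λ a c e i f j →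
      (e :+ i) :* a :+ (f :+ j) :* c := (e :* a :+ f :* c) :+ (i :* a :+ j :* c)) ≈-refl

    1x+0y : ∀ x y → 1# * x + 0# * y ≈ x
    1x+0y = solve 2 (λ x y → con 1 :* x :+ con 0 :* y := x) ≈-refl

    0x+1y : ∀ x y → 0# * x + 1# * y ≈ y
    0x+1y = solve 2 (λ x y → con 0 :* x :+ con 1 :* y := y) ≈-refl

    x1+y0 : ∀ x y → x * 1# + y * 0# ≈ x
    x1+y0 = solve 2 (λ x y → x :* con 1 :+ y :* con 0 := x) ≈-refl

    x0+y1 : ∀ x y → x * 0# + y * 1# ≈ y
    x0+y1 = solve 2 (λ x y → x :* con 0 :+ y :* con 1 := y) ≈-refl

τ-matrix : (r s q₁ q₂ q₃ q₄ : ℤ) → Matrix₂ ℤ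
τ-matrix r s q₁ q₂ q₃ q₄ = mat
  (q₁ - + 2 * r * q₃ - + 2 * s * q₄)
  (q₂ - + 2 * s * q₃ + + 2 * r * q₄)
  (- q₂ - + 2 * s * q₃ + + 2 * r * q₄)
  (q₁ + + 2 * r * q₃ + + 2 * s * q₄)
  where open Data.Integer.Base using (_+_; _-_; _*_; -_)

{-# OPTIONS --safe #-}

-- Let h = 2⁻¹ mod m and L = ℤ + ℤ i + ℤ √2 j + ℤ √2 k ⊂ H₁₂₂.  Since 2 q ∈ L
-- for every q ∈ H₁₂₂, we have q ≡ h (2 q) ∈ L mod m H₁₂₂, and τ (q) is the
-- matrix τ′ of the coordinates of h (2 q).  As 2 h ≡ 1 and h + r² + s² ≡ 0,
-- the matrices J = τ′ (√2 j) and K = τ′ (√2 k) satisfy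
-- J² = K² = 4 (r² + s²) ≡ -2 and J K = - K J ≡ 2 τ′ (i), so τ′ is
-- multiplicative; it is inverted by solving the linear system for q₁, …, q₄.
module Submission where

open import Algebra.Bundles using (Ring; CommutativeRing)
open import Algebra.Morphism.Structures using (IsRingIsomorphism)
import Algebra.Properties.AbelianGroup as AbelianGroupProperties
import Algebra.Properties.CommutativeMonoid.Mult as Mult
import Algebra.Properties.Ring as RingProperties
import Algebra.Properties.Semiring.Sum as SemiringSum
open import Data.Fin.Base using (Fin)
open import Data.Fin.Patterns using (0F; 1F; 2F; 3F)
open import Data.Integer.Base using (ℤ; +_; 0ℤ; 1ℤ; -1ℤ; _+_; _*_; -_; _-_)
import Data.Integer.Properties as ℤ
open import Data.Integer.Solver using (module +-*-Solver)
open import Data.Nat.Base using (ℕ; zero; suc)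
open import Data.Nat.Divisibility using (_∤_)
open import Data.Product.Base using (Σ-syntax; ∃-syntax; _×_; _,_; proj₁; proj₂)
open import Data.Rational.Base as ℚ using (0ℚ; ½; toℚᵘ)
import Data.Rational.Solver as ℚ
import Data.Rational.Unnormalised.Base as ℚᵘ
import Data.Rational.Unnormalised.Properties as ℚᵘ
open import Relation.Binary.PropositionalEquality
  using (_≡_; refl; sym; trans; cong; cong₂; subst; module ≡-Reasoning)
open import Defs

open ≡-Reasoning

-- An element of H₁₂₂ carries its coefficients as data, so `τ` must be shown to depend only on the
-- quaternion, and then only on its class. Both points are settled on 2q: its coordinate vector in L
-- is unique because `toℍ` is injective, and doubling maps m H₁₂₂ into m L. Multiplying by h undoes
-- the doubling modulo m, so elements of L that agree modulo m H₁₂₂ already agree coordinatewise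
-- modulo m; hence any representative in L gives the same matrix. Halves never enter the matrix
-- computations. What remains are congruences between integer polynomials that follow from 2 h - 1 ≡
-- 0 and h + r² + s² ≡ 0. Each is reduced to an identity over ℤ by giving the cofactors of these two
-- expressions explicitly.

record ℤ⁴ : Set where
  constructor ⟨_,_,_,_⟩
  field x₁ x₂ x₃ x₄ : ℤ

⟨⟩-cong : ∀ {a a′ b b′ c c′ d d′} → a ≡ a′ → b ≡ b′ → c ≡ c′ → d ≡ d′ →
          ⟨ a , b , c , d ⟩ ≡ ⟨ a′ , b′ , c′ , d′ ⟩
⟨⟩-cong refl refl refl refl = refl

-- Arithmetic of L in the basis 1, i, √2 j, √2 k.

infixl 6 _⊕_
infixl 7 _⋆_
infixr 7 _•_

-- `⋆` is quaternion multiplication on L. Its factors 2 come from (√2 j)² = (√2 k)² = -2 and (√2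
-- j)(√2 k) = 2 i; products with i need none, as i (√2 j) = √2 k.
_⊕_ _⋆_ : ℤ⁴ → ℤ⁴ → ℤ⁴
⟨ a , b , c , d ⟩ ⊕ ⟨ e , f , g , h ⟩ = ⟨ a + e , b + f , c + g , d + h ⟩
⟨ a , b , c , d ⟩ ⋆ ⟨ e , f , g , h ⟩ = ⟨
  a * e - b * f - + 2 * (c * g) - + 2 * (d * h) ,
  a * f + b * e + + 2 * (c * h) - + 2 * (d * g) ,
  a * g - b * h + c * e + d * f ,
  a * h + b * g - c * f + d * e ⟩

_•_ : ℤ → ℤ⁴ → ℤ⁴
n • ⟨ a , b , c , d ⟩ = ⟨ n * a , n * b , n * c , n * d ⟩

ℤ→√2ℚ : ℤ → ℚ√2
ℤ→√2ℚ n = 0ℚ +√2 ℤ→ℚ n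

toℍ : ℤ⁴ → Quaternion
toℍ ⟨ a , b , c , d ⟩ = quat (ℤ→ℚ√2 a) (ℤ→ℚ√2 b) (ℤ→√2ℚ c) (ℤ→√2ℚ d)

module K = CommutativeRing ℚ√2-commutativeRing

ℤ→√2ℚ-homo-+ : ∀ m n → ℤ→√2ℚ (m + n) ≡ ℤ→√2ℚ m K.+ ℤ→√2ℚ n
ℤ→√2ℚ-homo-+ m n = cong (0ℚ +√2_) (ℤ→ℚ-homo-+ m n)

ℤ→ℚ√2-homo-- : ∀ m n → ℤ→ℚ√2 (m - n) ≡ ℤ→ℚ√2 m K.- ℤ→ℚ√2 n
ℤ→ℚ√2-homo-- m n = trans (ℤ→ℚ√2-homo-+ m (- n))
  (cong (λ x → ℤ→ℚ√2 m K.+ (x +√2 0ℚ)) (ℤ→ℚ-homo‿- n))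

ℤ→√2ℚ-homo-- : ∀ m n → ℤ→√2ℚ (m - n) ≡ ℤ→√2ℚ m K.- ℤ→√2ℚ n
ℤ→√2ℚ-homo-- m n = trans (ℤ→√2ℚ-homo-+ m (- n))
  (cong (λ x → ℤ→√2ℚ m K.+ (0ℚ +√2 x)) (ℤ→ℚ-homo‿- n))

module _ where
  open ℚ.+-*-Solver

  ℤ→√2ℚ*ℤ→√2ℚ : ∀ m n → ℤ→ℚ√2 (+ 2 * (m * n)) ≡ ℤ→√2ℚ m K.* ℤ→√2ℚ n
  ℤ→√2ℚ*ℤ→√2ℚ m n = trans
    (cong (_+√2 0ℚ) (trans (ℤ→ℚ-homo-* (+ 2) (m * n)) (cong (2ℚ ℚ.*_) (ℤ→ℚ-homo-* m n))))
    (cong₂ _+√2_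
      (solve 2 (λ a b → con 2ℚ :* (a :* b) := con 0ℚ :* con 0ℚ :+ con 2ℚ :* (a :* b)) refl (ℤ→ℚ m) (ℤ→ℚ n))
      (solve 2 (λ a b → con 0ℚ := con 0ℚ :* b :+ a :* con 0ℚ) refl (ℤ→ℚ m) (ℤ→ℚ n)))

  ℤ→ℚ√2*ℤ→√2ℚ : ∀ m n → ℤ→√2ℚ (m * n) ≡ ℤ→ℚ√2 m K.* ℤ→√2ℚ n
  ℤ→ℚ√2*ℤ→√2ℚ m n = trans (cong (0ℚ +√2_) (ℤ→ℚ-homo-* m n)) (cong₂ _+√2_
    (solve 2 (λ a b → con 0ℚ := a :* con 0ℚ :+ con 2ℚ :* (con 0ℚ :* b)) refl (ℤ→ℚ m) (ℤ→ℚ n))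
    (solve 2 (λ a b → a :* b := a :* b :+ con 0ℚ :* con 0ℚ) refl (ℤ→ℚ m) (ℤ→ℚ n)))

ℤ→√2ℚ*ℤ→ℚ√2 : ∀ m n → ℤ→√2ℚ (m * n) ≡ ℤ→√2ℚ m K.* ℤ→ℚ√2 n
ℤ→√2ℚ*ℤ→ℚ√2 m n = begin
  ℤ→√2ℚ (m * n)          ≡⟨ cong ℤ→√2ℚ (ℤ.*-comm m n) ⟩
  ℤ→√2ℚ (n * m)          ≡⟨ ℤ→ℚ√2*ℤ→√2ℚ n m ⟩
  ℤ→ℚ√2 n K.* ℤ→√2ℚ m    ≡⟨ K.*-comm (ℤ→ℚ√2 n) (ℤ→√2ℚ m) ⟩
  ℤ→√2ℚ m K.* ℤ→ℚ√2 n    ∎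

toℍ-homo-⊕ : ∀ x y → toℍ (x ⊕ y) ≡ toℍ x ℍ.+ toℍ y
toℍ-homo-⊕ ⟨ a , b , c , d ⟩ ⟨ e , f , g , h ⟩ = quat-cong
  (ℤ→ℚ√2-homo-+ a e) (ℤ→ℚ√2-homo-+ b f) (ℤ→√2ℚ-homo-+ c g) (ℤ→√2ℚ-homo-+ d h)

-- A record, so that the arguments can be inferred from proofs.
record Image (f : ℤ → ℚ√2) (n : ℤ) (x : ℚ√2) : Set where
  constructor image
  field f[n]≡x : f n ≡ x

-- Coordinates are graded by parity in √2: the first two are integers (R), the last two integer
-- multiples of √2 (S). Products RR and SS fall into R, where SS gains the factor 2, and mixed
-- products fall into S.
toℍ-homo-⋆ : ∀ x y → toℍ (x ⋆ y) ≡ toℍ x ℍ.* toℍ y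
toℍ-homo-⋆ ⟨ a , b , c , d ⟩ ⟨ e , f , g , h ⟩ = quat-cong
  (f[n]≡x (R- (R- (R- (RR a e) (RR b f)) (SS c g)) (SS d h)))
  (f[n]≡x (R- (R+ (R+ (RR a f) (RR b e)) (SS c h)) (SS d g)))
  (f[n]≡x (S+ (S+ (S- (RS a g) (RS b h)) (SR c e)) (SR d f)))
  (f[n]≡x (S+ (S- (S+ (RS a h) (RS b g)) (SR c f)) (SR d e)))
  where
  open Image

  RR : ∀ m n → Image ℤ→ℚ√2 (m * n) (ℤ→ℚ√2 m K.* ℤ→ℚ√2 n)
  RR m n = image (ℤ→ℚ√2-homo-* m n)

  SS : ∀ m n → Image ℤ→ℚ√2 (+ 2 * (m * n)) (ℤ→√2ℚ m K.* ℤ→√2ℚ n)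
  SS m n = image (ℤ→√2ℚ*ℤ→√2ℚ m n)

  RS : ∀ m n → Image ℤ→√2ℚ (m * n) (ℤ→ℚ√2 m K.* ℤ→√2ℚ n)
  RS m n = image (ℤ→ℚ√2*ℤ→√2ℚ m n)

  SR : ∀ m n → Image ℤ→√2ℚ (m * n) (ℤ→√2ℚ m K.* ℤ→ℚ√2 n)
  SR m n = image (ℤ→√2ℚ*ℤ→ℚ√2 m n)

  R+ : ∀ {m n x y} → Image ℤ→ℚ√2 m x → Image ℤ→ℚ√2 n y → Image ℤ→ℚ√2 (m + n) (x K.+ y)
  R+ {m} {n} (image p) (image q) = image (trans (ℤ→ℚ√2-homo-+ m n) (cong₂ K._+_ p q))

  R- : ∀ {m n x y} → Image ℤ→ℚ√2 m x → Image ℤ→ℚ√2 n y → Image ℤ→ℚ√2 (m - n) (x K.- y)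
  R- {m} {n} (image p) (image q) = image (trans (ℤ→ℚ√2-homo-- m n) (cong₂ K._-_ p q))

  S+ : ∀ {m n x y} → Image ℤ→√2ℚ m x → Image ℤ→√2ℚ n y → Image ℤ→√2ℚ (m + n) (x K.+ y)
  S+ {m} {n} (image p) (image q) = image (trans (ℤ→√2ℚ-homo-+ m n) (cong₂ K._+_ p q))

  S- : ∀ {m n x y} → Image ℤ→√2ℚ m x → Image ℤ→√2ℚ n y → Image ℤ→√2ℚ (m - n) (x K.- y)
  S- {m} {n} (image p) (image q) = image (trans (ℤ→√2ℚ-homo-- m n) (cong₂ K._-_ p q))

ℤ→ℚ-injective : ∀ {m n} → ℤ→ℚ m ≡ ℤ→ℚ n → m ≡ n
ℤ→ℚ-injective {m} {n} m≡n =
  trans (sym (ℤ.*-identityʳ m)) (trans (ℚᵘ.drop-*≡* m≃n) (ℤ.*-identityʳ n))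
  where
  m≃n : ℚᵘ.mkℚᵘ m 0 ℚᵘ.≃ ℚᵘ.mkℚᵘ n 0
  m≃n = ℚᵘ.≃-trans (ℚᵘ.≃-sym (toℚᵘ-ℤ→ℚ m))
    (ℚᵘ.≃-trans (ℚᵘ.≃-reflexive (cong toℚᵘ m≡n)) (toℚᵘ-ℤ→ℚ n))

-- This makes coordinates unique, so identities in ℤ⁴ can be proved in the quaternions.
toℍ-injective : ∀ {x y} → toℍ x ≡ toℍ y → x ≡ y
toℍ-injective eq = ⟨⟩-cong
  (ℤ→ℚ-injective (cong (λ { (quat (a +√2 _) _ _ _) → a }) eq))
  (ℤ→ℚ-injective (cong (λ { (quat _ (b +√2 _) _ _) → b }) eq))
  (ℤ→ℚ-injective (cong (λ { (quat _ _ (_ +√2 c) _) → c }) eq))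
  (ℤ→ℚ-injective (cong (λ { (quat _ _ _ (_ +√2 d)) → d }) eq))

ι*toℍ : ∀ n x → ι n ℍ.* toℍ x ≡ toℍ (n • x)
ι*toℍ n x@(⟨ a , b , c , d ⟩) = begin
  toℍ ⟨ n , 0ℤ , 0ℤ , 0ℤ ⟩ ℍ.* toℍ x    ≡⟨ toℍ-homo-⋆ ⟨ n , 0ℤ , 0ℤ , 0ℤ ⟩ x ⟨
  toℍ (⟨ n , 0ℤ , 0ℤ , 0ℤ ⟩ ⋆ x)        ≡⟨ cong toℍ (⟨⟩-cong
    (solve 5 (λ n a b c d → n :* a :- z :* b :- con (+ 2) :* (z :* c) :- con (+ 2) :* (z :* d)
      := n :* a) refl n a b c d)
    (solve 5 (λ n a b c d → n :* b :+ z :* a :+ con (+ 2) :* (z :* d) :- con (+ 2) :* (z :* c)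
      := n :* b) refl n a b c d)
    (solve 5 (λ n a b c d → n :* c :- z :* d :+ z :* a :+ z :* b := n :* c) refl n a b c d)
    (solve 5 (λ n a b c d → n :* d :+ z :* c :- z :* b :+ z :* a := n :* d) refl n a b c d)) ⟩
  toℍ (n • x)                           ∎
  where
  open +-*-Solver
  z : ∀ {n} → Polynomial n
  z = con 0ℤ

-- The coordinate vector of 2q.

-- Opaque, because Agda would otherwise multiply out the coordinates of
-- products and of integral when it compares elements of ℤ⁴.
opaque
  doubled : H₁₂₂ → ℤ⁴
  doubled (_ , c , _) = ⟨ + 2 * c 0F + c 2F + c 3F , + 2 * c 1F + c 2F + c 3F , c 2F , c 3F ⟩

2v : Fin 4 → ℤ⁴
2v 0F = ⟨ + 2 , 0ℤ , 0ℤ , 0ℤ ⟩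
2v 1F = ⟨ 0ℤ , + 2 , 0ℤ , 0ℤ ⟩
2v 2F = ⟨ 1ℤ , 1ℤ , 1ℤ , 0ℤ ⟩
2v 3F = ⟨ 1ℤ , 1ℤ , 0ℤ , 1ℤ ⟩

ι2*v : ∀ i → ι (+ 2) ℍ.* v i ≡ toℍ (2v i)
ι2*v 0F = refl
ι2*v 1F = refl
ι2*v 2F = refl
ι2*v 3F = refl

ι-swap : ∀ m n q → ι m ℍ.* (ι n ℍ.* q) ≡ ι n ℍ.* (ι m ℍ.* q)
ι-swap m n q = begin
  ι m ℍ.* (ι n ℍ.* q)  ≡⟨ ℍ.*-assoc (ι m) (ι n) q ⟨
  ι m ℍ.* ι n ℍ.* q    ≡⟨ cong (ℍ._* q) (scalar-central (ℤ→ℚ√2 m) (ι n)) ⟩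
  ι n ℍ.* ι m ℍ.* q    ≡⟨ ℍ.*-assoc (ι n) (ι m) q ⟩
  ι n ℍ.* (ι m ℍ.* q)  ∎

open SemiringSum ℍ.semiring using (sum-syntax; sum-cong-≋; *-distribˡ-sum)

opaque
  unfolding doubled

  -- Both sides are linear in the coefficients of q, so the values `2v` on the four generators
  -- decide.
  ι2*≡toℍ-doubled : ∀ q → ι (+ 2) ℍ.* proj₁ q ≡ toℍ (doubled q)
  ι2*≡toℍ-doubled (_ , c , refl) = begin
    ι (+ 2) ℍ.* (∑[ i < 4 ] (ι (c i) ℍ.* v i))
      ≡⟨ *-distribˡ-sum (ι (+ 2)) (λ i → ι (c i) ℍ.* v i) ⟩
    ∑[ i < 4 ] (ι (+ 2) ℍ.* (ι (c i) ℍ.* v i))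
      ≡⟨ sum-cong-≋ (λ i → trans (ι-swap (+ 2) (c i) (v i))
           (trans (cong (ι (c i) ℍ.*_) (ι2*v i)) (ι*toℍ (c i) (2v i)))) ⟩
    ∑[ i < 4 ] (toℍ (c i • 2v i))
      -- The sum unfolds to a right-nested one ending in zero, which is `toℍ y₄`.
      ≡⟨⟩
    toℍ y₀ ℍ.+ (toℍ y₁ ℍ.+ (toℍ y₂ ℍ.+ (toℍ y₃ ℍ.+ toℍ y₄)))
      ≡⟨ toℍ-+ y₀ (toℍ-+ y₁ (toℍ-+ y₂ (toℍ-homo-⊕ y₃ y₄))) ⟨
    toℍ (y₀ ⊕ (y₁ ⊕ (y₂ ⊕ (y₃ ⊕ y₄))))
      ≡⟨ cong toℍ (⟨⟩-cong
           (solve 4 (λ a b c d → a :* con (+ 2) :+ (b :* z :+ (c :* o :+ (d :* o :+ z)))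
             := con (+ 2) :* a :+ c :+ d) refl (c 0F) (c 1F) (c 2F) (c 3F))
           (solve 4 (λ a b c d → a :* z :+ (b :* con (+ 2) :+ (c :* o :+ (d :* o :+ z)))
             := con (+ 2) :* b :+ c :+ d) refl (c 0F) (c 1F) (c 2F) (c 3F))
           (solve 4 (λ a b c d → a :* z :+ (b :* z :+ (c :* o :+ (d :* z :+ z)))
             := c) refl (c 0F) (c 1F) (c 2F) (c 3F))
           (solve 4 (λ a b c d → a :* z :+ (b :* z :+ (c :* z :+ (d :* o :+ z)))
             := d) refl (c 0F) (c 1F) (c 2F) (c 3F))) ⟩
    toℍ (doubled (_ , c , refl)) ∎
    where
    open +-*-Solver
    z o : ∀ {n} → Polynomial n
    z = con 0ℤ
    o = con 1ℤ

    y₀ y₁ y₂ y₃ y₄ : ℤ⁴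
    y₀ = c 0F • 2v 0F
    y₁ = c 1F • 2v 1F
    y₂ = c 2F • 2v 2F
    y₃ = c 3F • 2v 3F
    y₄ = ⟨ 0ℤ , 0ℤ , 0ℤ , 0ℤ ⟩

    toℍ-+ : ∀ x {y q} → toℍ y ≡ q → toℍ (x ⊕ y) ≡ toℍ x ℍ.+ q
    toℍ-+ x {y} p = trans (toℍ-homo-⊕ x y) (cong (toℍ x ℍ.+_) p)

module H = Ring H₁₂₂-ring
open Mult H.+-commutativeMonoid using () renaming (_×_ to _·_)

ι2-cancel : ∀ {p q} → ι (+ 2) ℍ.* p ≡ ι (+ 2) ℍ.* q → p ≡ q
ι2-cancel {p} {q} eq = trans (sym (½*2* p)) (trans (cong (scalar ½K ℍ.*_) eq) (½*2* q))
  where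
  ½*2* : ∀ p → scalar ½K ℍ.* (ι (+ 2) ℍ.* p) ≡ p
  -- `scalar ½K ℍ.* ι (+ 2)` computes to `ℍ.1#`.
  ½*2* p = trans (sym (ℍ.*-assoc (scalar ½K) (ι (+ 2)) p)) (ℍ.*-identityˡ p)

*-ι : ∀ p n q → p ℍ.* (ι n ℍ.* q) ≡ ι n ℍ.* (p ℍ.* q)
*-ι p n q = begin
  p ℍ.* (ι n ℍ.* q)  ≡⟨ ℍ.*-assoc p (ι n) q ⟨
  p ℍ.* ι n ℍ.* q    ≡⟨ cong (ℍ._* q) (scalar-central (ℤ→ℚ√2 n) p) ⟨
  ι n ℍ.* p ℍ.* q    ≡⟨ ℍ.*-assoc (ι n) p q ⟩
  ι n ℍ.* (p ℍ.* q)  ∎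

proj₁-· : ∀ m z → proj₁ (m · z) ≡ ι (+ m) ℍ.* proj₁ z
proj₁-· zero    z = sym (ℍ.zeroˡ (proj₁ z))
proj₁-· (suc m) z = begin
  proj₁ z ℍ.+ proj₁ (m · z)                      ≡⟨ cong₂ ℍ._+_ (sym (ℍ.*-identityˡ _)) (proj₁-· m z) ⟩
  ι 1ℤ ℍ.* proj₁ z ℍ.+ ι (+ m) ℍ.* proj₁ z       ≡⟨ ℍ.distribʳ (proj₁ z) (ι 1ℤ) (ι (+ m)) ⟨
  (ι 1ℤ ℍ.+ ι (+ m)) ℍ.* proj₁ z                 ≡⟨ cong (ℍ._* proj₁ z) (ι-homo-+ 1ℤ (+ m)) ⟨
  ι (+ suc m) ℍ.* proj₁ z                        ∎

-- The characterisation of `doubled` that lets the rules below be proved without unfolding it.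
doubled-unique : ∀ q {x} → ι (+ 2) ℍ.* proj₁ q ≡ toℍ x → doubled q ≡ x
doubled-unique q eq = toℍ-injective (trans (sym (ι2*≡toℍ-doubled q)) eq)

doubled-cong : ∀ p q → proj₁ p ≡ proj₁ q → doubled p ≡ doubled q
doubled-cong p q eq = doubled-unique p (trans (cong (ι (+ 2) ℍ.*_) eq) (ι2*≡toℍ-doubled q))

doubled-homo-+ : ∀ p q → doubled (p H.+ q) ≡ doubled p ⊕ doubled q
doubled-homo-+ p q = doubled-unique (p H.+ q) (begin
  ι (+ 2) ℍ.* (proj₁ p ℍ.+ proj₁ q)                    ≡⟨ ℍ.distribˡ (ι (+ 2)) (proj₁ p) (proj₁ q) ⟩
  ι (+ 2) ℍ.* proj₁ p ℍ.+ ι (+ 2) ℍ.* proj₁ q          ≡⟨ cong₂ ℍ._+_ (ι2*≡toℍ-doubled p) (ι2*≡toℍ-doubled q) ⟩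
  toℍ (doubled p) ℍ.+ toℍ (doubled q)                  ≡⟨ toℍ-homo-⊕ (doubled p) (doubled q) ⟨
  toℍ (doubled p ⊕ doubled q)                          ∎)

-- The multiple is given by an equation between quaternions, so that one rule covers both the
-- negation in H₁₂₂ (n = -1) and the iterated sum `m · z` that defines the ideal.
doubled-ι* : ∀ n p q → proj₁ p ≡ ι n ℍ.* proj₁ q → doubled p ≡ n • doubled q
doubled-ι* n p q eq = doubled-unique p (begin
  ι (+ 2) ℍ.* proj₁ p               ≡⟨ cong (ι (+ 2) ℍ.*_) eq ⟩
  ι (+ 2) ℍ.* (ι n ℍ.* proj₁ q)     ≡⟨ *-ι (ι (+ 2)) n (proj₁ q) ⟩
  ι n ℍ.* (ι (+ 2) ℍ.* proj₁ q)     ≡⟨ cong (ι n ℍ.*_) (ι2*≡toℍ-doubled q) ⟩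
  ι n ℍ.* toℍ (doubled q)           ≡⟨ ι*toℍ n (doubled q) ⟩
  toℍ (n • doubled q)               ∎)

doubled-homo-- : ∀ q → doubled (H.- q) ≡ -1ℤ • doubled q
doubled-homo-- q = doubled-ι* -1ℤ (H.- q) q (sym (-1*x≈-x (proj₁ q)))
  where open RingProperties ℍ-ring using (-1*x≈-x)

-- Because (2p)(2q) = 2 (2pq), a factor 2 is left over; it is cancelled by h later.
doubled-homo-* : ∀ p q → + 2 • doubled (p H.* q) ≡ doubled p ⋆ doubled q
doubled-homo-* p q = toℍ-injective (begin
  toℍ (+ 2 • doubled (p H.* q))                        ≡⟨ ι*toℍ (+ 2) (doubled (p H.* q)) ⟨
  ι (+ 2) ℍ.* toℍ (doubled (p H.* q))                  ≡⟨ cong (ι (+ 2) ℍ.*_) (ι2*≡toℍ-doubled (p H.* q)) ⟨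
  ι (+ 2) ℍ.* (ι (+ 2) ℍ.* (proj₁ p ℍ.* proj₁ q))      ≡⟨ cong (ι (+ 2) ℍ.*_) (*-ι (proj₁ p) (+ 2) (proj₁ q)) ⟨
  ι (+ 2) ℍ.* (proj₁ p ℍ.* (ι (+ 2) ℍ.* proj₁ q))      ≡⟨ ℍ.*-assoc (ι (+ 2)) (proj₁ p) (ι (+ 2) ℍ.* proj₁ q) ⟨
  (ι (+ 2) ℍ.* proj₁ p) ℍ.* (ι (+ 2) ℍ.* proj₁ q)      ≡⟨ cong₂ ℍ._*_ (ι2*≡toℍ-doubled p) (ι2*≡toℍ-doubled q) ⟩
  toℍ (doubled p) ℍ.* toℍ (doubled q)                  ≡⟨ toℍ-homo-⋆ (doubled p) (doubled q) ⟨
  toℍ (doubled p ⋆ doubled q)                          ∎)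

fromℤ⁴ : ℤ⁴ → H₁₂₂
fromℤ⁴ ⟨ a , b , c , d ⟩ = integral a b c d

proj₁-fromℤ⁴ : ∀ x → proj₁ (fromℤ⁴ x) ≡ toℍ x
proj₁-fromℤ⁴ ⟨ a , b , c , d ⟩ = begin
  ι a ℍ.* toℍ e₁ ℍ.+ ι b ℍ.* toℍ e₂ ℍ.+ ι c ℍ.* toℍ e₃ ℍ.+ ι d ℍ.* toℍ e₄
    ≡⟨ cong₂ ℍ._+_ (cong₂ ℍ._+_ (cong₂ ℍ._+_ (ι*toℍ a e₁) (ι*toℍ b e₂)) (ι*toℍ c e₃)) (ι*toℍ d e₄) ⟩
  toℍ (a • e₁) ℍ.+ toℍ (b • e₂) ℍ.+ toℍ (c • e₃) ℍ.+ toℍ (d • e₄)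
    ≡⟨ cong (λ q → q ℍ.+ toℍ (c • e₃) ℍ.+ toℍ (d • e₄)) (toℍ-homo-⊕ (a • e₁) (b • e₂)) ⟨
  toℍ (a • e₁ ⊕ b • e₂) ℍ.+ toℍ (c • e₃) ℍ.+ toℍ (d • e₄)
    ≡⟨ cong (ℍ._+ toℍ (d • e₄)) (toℍ-homo-⊕ (a • e₁ ⊕ b • e₂) (c • e₃)) ⟨
  toℍ (a • e₁ ⊕ b • e₂ ⊕ c • e₃) ℍ.+ toℍ (d • e₄)
    ≡⟨ toℍ-homo-⊕ (a • e₁ ⊕ b • e₂ ⊕ c • e₃) (d • e₄) ⟨
  toℍ (a • e₁ ⊕ b • e₂ ⊕ c • e₃ ⊕ d • e₄)
    ≡⟨ cong toℍ (⟨⟩-cong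
         (solve 4 (λ a b c d → a :* o :+ b :* z :+ c :* z :+ d :* z := a) refl a b c d)
         (solve 4 (λ a b c d → a :* z :+ b :* o :+ c :* z :+ d :* z := b) refl a b c d)
         (solve 4 (λ a b c d → a :* z :+ b :* z :+ c :* o :+ d :* z := c) refl a b c d)
         (solve 4 (λ a b c d → a :* z :+ b :* z :+ c :* z :+ d :* o := d) refl a b c d)) ⟩
  toℍ ⟨ a , b , c , d ⟩
    ∎
  where
  open +-*-Solver
  z o : ∀ {n} → Polynomial n
  z = con 0ℤ
  o = con 1ℤ

  e₁ e₂ e₃ e₄ : ℤ⁴
  e₁ = ⟨ 1ℤ , 0ℤ , 0ℤ , 0ℤ ⟩
  e₂ = ⟨ 0ℤ , 1ℤ , 0ℤ , 0ℤ ⟩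
  e₃ = ⟨ 0ℤ , 0ℤ , 1ℤ , 0ℤ ⟩
  e₄ = ⟨ 0ℤ , 0ℤ , 0ℤ , 1ℤ ⟩

doubled-fromℤ⁴ : ∀ x → doubled (fromℤ⁴ x) ≡ + 2 • x
doubled-fromℤ⁴ x = doubled-unique (fromℤ⁴ x)
  (trans (cong (ι (+ 2) ℍ.*_) (proj₁-fromℤ⁴ x)) (ι*toℍ (+ 2) x))

-- The norm on L and on H₁₂₂.

norm : ℤ⁴ → ℤ
norm ⟨ a , b , c , d ⟩ = a * a + b * b + + 2 * (c * c) + + 2 * (d * d)

N-toℍ : ∀ x → N (toℍ x) ≡ ι (norm x)
N-toℍ x@(⟨ a , b , c , d ⟩) = begin
  toℍ x ℍ.* conj (toℍ x)     ≡⟨ cong (toℍ x ℍ.*_) (quat-cong refl (neg-R b) (neg-S c) (neg-S d)) ⟩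
  toℍ x ℍ.* toℍ x̄            ≡⟨ toℍ-homo-⋆ x x̄ ⟨
  toℍ (x ⋆ x̄)                ≡⟨ cong toℍ (⟨⟩-cong
    (solve 4 (λ a b c d → a :* a :- b :* :- b :- t :* (c :* :- c) :- t :* (d :* :- d)
      := a :* a :+ b :* b :+ t :* (c :* c) :+ t :* (d :* d)) refl a b c d)
    (solve 4 (λ a b c d → a :* :- b :+ b :* a :+ t :* (c :* :- d) :- t :* (d :* :- c)
      := con 0ℤ) refl a b c d)
    (solve 4 (λ a b c d → a :* :- c :- b :* :- d :+ c :* a :+ d :* :- b
      := con 0ℤ) refl a b c d)
    (solve 4 (λ a b c d → a :* :- d :+ b :* :- c :- c :* :- b :+ d :* a
      := con 0ℤ) refl a b c d)) ⟩
  ι (norm x)                 ∎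
  where
  open +-*-Solver
  t : ∀ {n} → Polynomial n
  t = con (+ 2)

  x̄ : ℤ⁴
  x̄ = ⟨ a , - b , - c , - d ⟩

  neg-R : ∀ n → K.- ℤ→ℚ√2 n ≡ ℤ→ℚ√2 (- n)
  neg-R n = sym (cong (_+√2 _) (ℤ→ℚ-homo‿- n))

  neg-S : ∀ n → K.- ℤ→√2ℚ n ≡ ℤ→√2ℚ (- n)
  neg-S n = sym (cong (_ +√2_) (ℤ→ℚ-homo‿- n))

conj-homo-+ : ∀ p q → conj (p ℍ.+ q) ≡ conj p ℍ.+ conj q
conj-homo-+ (quat a b c d) (quat e f g h) = quat-cong refl
  (sym (-‿+-comm b f)) (sym (-‿+-comm c g)) (sym (-‿+-comm d h))
  where open RingProperties K.ring using (-‿+-comm)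

conj-2* : ∀ q → conj (ι (+ 2) ℍ.* q) ≡ ι (+ 2) ℍ.* conj q
conj-2* q = trans (cong conj (2*≡+ q)) (trans (conj-homo-+ q q) (sym (2*≡+ (conj q))))
  where
  2*≡+ : ∀ q → ι (+ 2) ℍ.* q ≡ q ℍ.+ q
  2*≡+ q = trans (ℍ.distribʳ q ℍ.1# ℍ.1#) (cong₂ ℍ._+_ (ℍ.*-identityˡ q) (ℍ.*-identityˡ q))

N-2* : ∀ q → N (ι (+ 2) ℍ.* q) ≡ ι (+ 2) ℍ.* (ι (+ 2) ℍ.* N q)
N-2* q = begin
  ι (+ 2) ℍ.* q ℍ.* conj (ι (+ 2) ℍ.* q)      ≡⟨ cong (ι (+ 2) ℍ.* q ℍ.*_) (conj-2* q) ⟩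
  ι (+ 2) ℍ.* q ℍ.* (ι (+ 2) ℍ.* conj q)      ≡⟨ ℍ.*-assoc (ι (+ 2)) q (ι (+ 2) ℍ.* conj q) ⟩
  ι (+ 2) ℍ.* (q ℍ.* (ι (+ 2) ℍ.* conj q))    ≡⟨ cong (ι (+ 2) ℍ.*_) (*-ι q (+ 2) (conj q)) ⟩
  ι (+ 2) ℍ.* (ι (+ 2) ℍ.* N q)               ∎

-- The norm form in the basis v₁, ..., v₄, obtained by dividing the norm of 2q by 4; its integer
-- coefficients show that N is integral on H₁₂₂.
norm₁₂₂ : H₁₂₂ → ℤ
norm₁₂₂ (_ , k , _) =
  a * a + b * b + (a + b) * (c + d) + c * c + d * d + c * d
  where
  a = k 0F
  b = k 1F
  c = k 2F
  d = k 3F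

opaque
  unfolding doubled

  norm-doubled : ∀ q → norm (doubled q) ≡ + 2 * (+ 2 * norm₁₂₂ q)
  norm-doubled (_ , k , _) = solve 4 (λ a b c d →
    (t :* a :+ c :+ d) :* (t :* a :+ c :+ d) :+ (t :* b :+ c :+ d) :* (t :* b :+ c :+ d)
    :+ t :* (c :* c) :+ t :* (d :* d)
    := t :* (t :* (a :* a :+ b :* b :+ (a :+ b) :* (c :+ d) :+ c :* c :+ d :* d :+ c :* d)))
    refl (k 0F) (k 1F) (k 2F) (k 3F)
    where
    open +-*-Solver
    t : ∀ {n} → Polynomial n
    t = con (+ 2)

-- N(2q) = 4 N(q), and 2 can be cancelled twice in the quaternions over ℚ(√2).
N≡ι-norm₁₂₂ : ∀ q → N (proj₁ q) ≡ ι (norm₁₂₂ q)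
N≡ι-norm₁₂₂ q = ι2-cancel (ι2-cancel (begin
  ι (+ 2) ℍ.* (ι (+ 2) ℍ.* N (proj₁ q))        ≡⟨ N-2* (proj₁ q) ⟨
  N (ι (+ 2) ℍ.* proj₁ q)                      ≡⟨ cong N (ι2*≡toℍ-doubled q) ⟩
  N (toℍ (doubled q))                          ≡⟨ N-toℍ (doubled q) ⟩
  ι (norm (doubled q))                         ≡⟨ cong ι (norm-doubled q) ⟩
  ι (+ 2 * (+ 2 * norm₁₂₂ q))                  ≡⟨ ι-homo-* (+ 2) (+ 2 * norm₁₂₂ q) ⟩
  ι (+ 2) ℍ.* ι (+ 2 * norm₁₂₂ q)              ≡⟨ cong (ι (+ 2) ℍ.*_) (ι-homo-* (+ 2) (norm₁₂₂ q)) ⟩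
  ι (+ 2) ℍ.* (ι (+ 2) ℍ.* ι (norm₁₂₂ q))      ∎))

·≡* : ∀ m n → Mult._×_ ℤ.+-0-commutativeMonoid m n ≡ + m * n
·≡* zero    n = refl
·≡* (suc m) n = trans (cong (λ x → n + x) (·≡* m n)) (sym (ℤ.suc-* (+ m) n))

-- The inverse of τ-matrix when 2 h = 1 and h + r² + s² = 0.
σ : (h r s : ℤ) → Matrix₂ ℤ → ℤ⁴
σ h r s (mat α β γ δ) = ⟨
  h * (α + δ) ,
  h * (β - γ) ,
  - h * (r * (δ - α) - s * (β + γ)) ,
  - h * (r * (β + γ) + s * (δ - α)) ⟩

•-distribˡ-⊕ : ∀ n x y → n • (x ⊕ y) ≡ n • x ⊕ n • y
•-distribˡ-⊕ n ⟨ a , b , c , d ⟩ ⟨ e , f , g , h ⟩ = ⟨⟩-cong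
  (ℤ.*-distribˡ-+ n a e) (ℤ.*-distribˡ-+ n b f) (ℤ.*-distribˡ-+ n c g) (ℤ.*-distribˡ-+ n d h)

-- The entries of τ-matrix, the coordinates of _⋆_, and 2 + 4 (r² + s²).
module Polynomials where
  open +-*-Solver public

  private
    t : ∀ {n} → Polynomial n
    t = con (+ 2)

  α β γ δ : ∀ {n} (r s x y z : Polynomial n) → Polynomial n
  α r s x₁ x₃ x₄ = x₁ :- t :* r :* x₃ :- t :* s :* x₄
  β r s x₂ x₃ x₄ = x₂ :- t :* s :* x₃ :+ t :* r :* x₄
  γ r s x₂ x₃ x₄ = :- x₂ :- t :* s :* x₃ :+ t :* r :* x₄
  δ r s x₁ x₃ x₄ = x₁ :+ t :* r :* x₃ :+ t :* s :* x₄

  ⋆₁ ⋆₂ ⋆₃ ⋆₄ : ∀ {n} (a b c d e f g h : Polynomial n) → Polynomial n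
  ⋆₁ a b c d e f g h = a :* e :- b :* f :- t :* (c :* g) :- t :* (d :* h)
  ⋆₂ a b c d e f g h = a :* f :+ b :* e :+ t :* (c :* h) :- t :* (d :* g)
  ⋆₃ a b c d e f g h = a :* g :- b :* h :+ c :* e :+ d :* f
  ⋆₄ a b c d e f g h = a :* h :+ b :* g :- c :* f :+ d :* e

  w : ∀ {n} (r s : Polynomial n) → Polynomial n
  w r s = con (+ 2) :+ con (+ 4) :* (r :* r :+ s :* s)

•-⋆-• : ∀ n x y → (n • x) ⋆ (n • y) ≡ n • n • (x ⋆ y)
•-⋆-• n ⟨ a , b , c , d ⟩ ⟨ e , f , g , i ⟩ = ⟨⟩-cong
  (solve 9 (λ n a b c d e f g i →
    n :* a :* (n :* e) :- n :* b :* (n :* f) :- t :* (n :* c :* (n :* g)) :- t :* (n :* d :* (n :* i))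
    := n :* (n :* (a :* e :- b :* f :- t :* (c :* g) :- t :* (d :* i)))) refl n a b c d e f g i)
  (solve 9 (λ n a b c d e f g i →
    n :* a :* (n :* f) :+ n :* b :* (n :* e) :+ t :* (n :* c :* (n :* i)) :- t :* (n :* d :* (n :* g))
    := n :* (n :* (a :* f :+ b :* e :+ t :* (c :* i) :- t :* (d :* g)))) refl n a b c d e f g i)
  (solve 9 (λ n a b c d e f g i →
    n :* a :* (n :* g) :- n :* b :* (n :* i) :+ n :* c :* (n :* e) :+ n :* d :* (n :* f)
    := n :* (n :* (a :* g :- b :* i :+ c :* e :+ d :* f))) refl n a b c d e f g i)
  (solve 9 (λ n a b c d e f g i →
    n :* a :* (n :* i) :+ n :* b :* (n :* g) :- n :* c :* (n :* f) :+ n :* d :* (n :* e)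
    := n :* (n :* (a :* i :+ b :* g :- c :* f :+ d :* e))) refl n a b c d e f g i)
  where
  open +-*-Solver
  t : ∀ {n} → Polynomial n
  t = con (+ 2)

-- Congruences modulo m in ℤ, ℤ⁴ and H₁₂₂.

module Congruence (m : ℕ) where
  module ℤ/m = CommutativeRing (ℤ/ m)
  module H/m = Ring (H₁₂₂/ m)
  module M/m = Ring (M₂ (ℤ/ m))

  -- A record, so that the endpoints can be inferred from proofs.
  infix 4 _≋_
  record _≋_ (x y : ℤ) : Set where
    constructor [_]
    field ≋⇒≈ : x ℤ/m.≈ y
  open _≋_ public

  ≋-reflexive : ∀ {x y} → x ≡ y → x ≋ y
  ≋-reflexive {x} refl = [ ℤ/m.refl {x} ]

  ≋-refl : ∀ {x} → x ≋ x
  ≋-refl = ≋-reflexive refl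

  ≋-sym : ∀ {x y} → x ≋ y → y ≋ x
  ≋-sym {x} {y} [ p ] = [ ℤ/m.sym {x} {y} p ]

  ≋-trans : ∀ {x y z} → x ≋ y → y ≋ z → x ≋ z
  ≋-trans {x} {y} {z} [ p ] [ q ] = [ ℤ/m.trans {x} {y} {z} p q ]

  +-cong : ∀ {x x′ y y′} → x ≋ x′ → y ≋ y′ → x + y ≋ x′ + y′
  +-cong {x} {x′} {y} {y′} [ p ] [ q ] = [ ℤ/m.+-cong {x} {x′} {y} {y′} p q ]

  *-congˡ : ∀ x {y y′} → y ≋ y′ → x * y ≋ x * y′
  *-congˡ x {y} {y′} [ p ] = [ ℤ/m.*-congˡ {x} {y} {y′} p ]

  -‿cong : ∀ {x x′} → x ≋ x′ → - x ≋ - x′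
  -‿cong {x} {x′} [ p ] = [ ℤ/m.-‿cong {x} {x′} p ]

  minus-cong : ∀ {x x′ y y′} → x ≋ x′ → y ≋ y′ → x - y ≋ x′ - y′
  minus-cong p q = +-cong p (-‿cong q)

  ≋-quotient : ∀ {x y} → x ≋ y → ∃[ k ] x ≡ y + + m * k
  ≋-quotient {x} {y} [ k , x-y≡mk ] = k , (begin
    x              ≡⟨ solve 2 (λ x y → x := y :+ (x :- y)) refl x y ⟩
    y + (x - y)    ≡⟨ cong (λ x → y + x) (trans x-y≡mk (·≡* m k)) ⟩
    y + + m * k    ∎)
    where open +-*-Solver

  ≋-intro : ∀ {x y} k → x ≡ y + + m * k → x ≋ y
  ≋-intro {y = y} k refl = [ k , (begin
    y + + m * k - y      ≡⟨ solve 2 (λ y z → y :+ z :- y := z) refl y (+ m * k) ⟩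
    + m * k              ≡⟨ ·≡* m k ⟨
    Mult._×_ ℤ.+-0-commutativeMonoid m k ∎) ]
    where open +-*-Solver

  infix 4 _≋⁴_
  record _≋⁴_ (x y : ℤ⁴) : Set where
    constructor pointwise
    private
      module x = ℤ⁴ x
      module y = ℤ⁴ y
    field
      x₁ : x.x₁ ≋ y.x₁
      x₂ : x.x₂ ≋ y.x₂
      x₃ : x.x₃ ≋ y.x₃
      x₄ : x.x₄ ≋ y.x₄

  ≋⁴-reflexive : ∀ {x y} → x ≡ y → x ≋⁴ y
  ≋⁴-reflexive refl = pointwise ≋-refl ≋-refl ≋-refl ≋-refl

  ≋⁴-sym : ∀ {x y} → x ≋⁴ y → y ≋⁴ x
  ≋⁴-sym (pointwise p q r s) = pointwise (≋-sym p) (≋-sym q) (≋-sym r) (≋-sym s)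

  ≋⁴-trans : ∀ {x y z} → x ≋⁴ y → y ≋⁴ z → x ≋⁴ z
  ≋⁴-trans (pointwise p q r s) (pointwise p′ q′ r′ s′) =
    pointwise (≋-trans p p′) (≋-trans q q′) (≋-trans r r′) (≋-trans s s′)

  •-cong : ∀ n {x y} → x ≋⁴ y → n • x ≋⁴ n • y
  •-cong n (pointwise p q r s) = pointwise (*-congˡ n p) (*-congˡ n q) (*-congˡ n r) (*-congˡ n s)

  mat≋ : ∀ {a a′ b b′ c c′ d d′} → a ≋ a′ → b ≋ b′ → c ≋ c′ → d ≋ d′ →
         mat a b c d M/m.≈ mat a′ b′ c′ d′
  mat≋ p q r s = mat≈ (≋⇒≈ p) (≋⇒≈ q) (≋⇒≈ r) (≋⇒≈ s)

  H/m-intro : ∀ p q z → proj₁ p ≡ proj₁ q ℍ.+ ι (+ m) ℍ.* proj₁ z → p H/m.≈ q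
  H/m-intro p q z eq = z , (begin
    proj₁ p ℍ.- proj₁ q                                    ≡⟨ cong (ℍ._- proj₁ q) eq ⟩
    proj₁ q ℍ.+ ι (+ m) ℍ.* proj₁ z ℍ.- proj₁ q            ≡⟨ xyx⁻¹≈y (proj₁ q) (ι (+ m) ℍ.* proj₁ z) ⟩
    ι (+ m) ℍ.* proj₁ z                                    ≡⟨ proj₁-· m z ⟨
    proj₁ (Mult._×_ H.+-commutativeMonoid m z)             ∎)
    where open AbelianGroupProperties ℍ.+-abelianGroup using (xyx⁻¹≈y)

  -- If p = q + m z with z in H₁₂₂, then 2p = 2q + m (2z), and 2z has integer coordinates in L.
  doubled-mod : ∀ p q → p H/m.≈ q → doubled p ≋⁴ doubled q
  doubled-mod p q (z , eq) = pointwise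
    (≋-intro (ℤ⁴.x₁ k) (cong ℤ⁴.x₁ p≡q+mk)) (≋-intro (ℤ⁴.x₂ k) (cong ℤ⁴.x₂ p≡q+mk))
    (≋-intro (ℤ⁴.x₃ k) (cong ℤ⁴.x₃ p≡q+mk)) (≋-intro (ℤ⁴.x₄ k) (cong ℤ⁴.x₄ p≡q+mk))
    where
    open AbelianGroupProperties ℍ.+-abelianGroup using (xyx⁻¹≈y)
    mz = Mult._×_ H.+-commutativeMonoid m z
    k = doubled z

    p≡q+mz : proj₁ p ≡ proj₁ (q H.+ mz)
    p≡q+mz = begin
      proj₁ p                             ≡⟨ xyx⁻¹≈y (proj₁ q) (proj₁ p) ⟨
      proj₁ q ℍ.+ proj₁ p ℍ.- proj₁ q     ≡⟨ ℍ.+-assoc (proj₁ q) (proj₁ p) (ℍ.- proj₁ q) ⟩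
      proj₁ q ℍ.+ (proj₁ p ℍ.- proj₁ q)   ≡⟨ cong (proj₁ q ℍ.+_) eq ⟩
      proj₁ (q H.+ mz)                    ∎

    p≡q+mk : doubled p ≡ doubled q ⊕ + m • k
    p≡q+mk = begin
      doubled p                 ≡⟨ doubled-cong p (q H.+ mz) p≡q+mz ⟩
      doubled (q H.+ mz)        ≡⟨ doubled-homo-+ q mz ⟩
      doubled q ⊕ doubled mz    ≡⟨ cong (doubled q ⊕_) (doubled-ι* (+ m) mz z (proj₁-· m z)) ⟩
      doubled q ⊕ + m • k       ∎

  -- The coordinatewise quotients form a vector of L, and m L lies in m H₁₂₂.
  fromℤ⁴-cong : ∀ {x y} → x ≋⁴ y → fromℤ⁴ x H/m.≈ fromℤ⁴ y
  fromℤ⁴-cong {x} {y} (pointwise p q r s) = H/m-intro (fromℤ⁴ x) (fromℤ⁴ y) (fromℤ⁴ k) (begin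
    proj₁ (fromℤ⁴ x)                                     ≡⟨ proj₁-fromℤ⁴ x ⟩
    toℍ x                                                ≡⟨ cong toℍ x≡y+mk ⟩
    toℍ (y ⊕ + m • k)                                    ≡⟨ toℍ-homo-⊕ y (+ m • k) ⟩
    toℍ y ℍ.+ toℍ (+ m • k)                              ≡⟨ cong (toℍ y ℍ.+_) (ι*toℍ (+ m) k) ⟨
    toℍ y ℍ.+ ι (+ m) ℍ.* toℍ k
      ≡⟨ cong₂ (λ u v → u ℍ.+ ι (+ m) ℍ.* v) (proj₁-fromℤ⁴ y) (proj₁-fromℤ⁴ k) ⟨
    proj₁ (fromℤ⁴ y) ℍ.+ ι (+ m) ℍ.* proj₁ (fromℤ⁴ k)    ∎)
    where
    k : ℤ⁴
    k = ⟨ proj₁ (≋-quotient p) , proj₁ (≋-quotient q)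
        , proj₁ (≋-quotient r) , proj₁ (≋-quotient s) ⟩

    x≡y+mk : x ≡ y ⊕ + m • k
    x≡y+mk = ⟨⟩-cong (proj₂ (≋-quotient p)) (proj₂ (≋-quotient q))
                     (proj₂ (≋-quotient r)) (proj₂ (≋-quotient s))

-- The map `τ`, its inverse and its determinant.

module Isomorphism
  (m : ℕ) (h r s : ℤ)
  (2h≋1 : Congruence._≋_ m (+ 2 * h) 1ℤ)
  (h+r²+s²≋0 : Congruence._≋_ m (h + r * r + s * s) 0ℤ)
  where

  open Congruence m

  τ′ : ℤ⁴ → Matrix₂ ℤ
  τ′ ⟨ a , b , c , d ⟩ = τ-matrix r s a b c d

  τ : H₁₂₂ → Matrix₂ ℤ
  τ q = τ′ (h • doubled q)

  τ′-cong : ∀ {x y} → x ≋⁴ y → τ′ x M/m.≈ τ′ y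
  τ′-cong (pointwise p₁ p₂ p₃ p₄) = mat≋
    (minus-cong (minus-cong p₁ (*-congˡ (+ 2 * r) p₃)) (*-congˡ (+ 2 * s) p₄))
    (+-cong (minus-cong p₂ (*-congˡ (+ 2 * s) p₃)) (*-congˡ (+ 2 * r) p₄))
    (+-cong (minus-cong (-‿cong p₂) (*-congˡ (+ 2 * s) p₃)) (*-congˡ (+ 2 * r) p₄))
    (+-cong (+-cong p₁ (*-congˡ (+ 2 * r) p₃)) (*-congˡ (+ 2 * s) p₄))

  σ-cong : ∀ {A B} → A M/m.≈ B → σ h r s A ≋⁴ σ h r s B
  σ-cong {mat α β γ δ} {mat α′ β′ γ′ δ′} (mat≈ α≈ β≈ γ≈ δ≈) = pointwise
    (*-congˡ h (+-cong α≋ δ≋))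
    (*-congˡ h (minus-cong β≋ γ≋))
    (*-congˡ (- h) (minus-cong (*-congˡ r (minus-cong δ≋ α≋)) (*-congˡ s (+-cong β≋ γ≋))))
    (*-congˡ (- h) (+-cong (*-congˡ r (+-cong β≋ γ≋)) (*-congˡ s (minus-cong δ≋ α≋))))
    where
    α≋ : α ≋ α′
    α≋ = [ α≈ ]
    β≋ : β ≋ β′
    β≋ = [ β≈ ]
    γ≋ : γ ≋ γ′
    γ≋ = [ γ≈ ]
    δ≋ : δ ≋ δ′
    δ≋ = [ δ≈ ]

  -- Here a and b are the cofactors of 2 h - 1 and h + r² + s², both multiples of m. Only a
  -- polynomial identity over ℤ is left for the ring solver.
  modulo : ∀ {x y} a b →
    x ≡ y + (a * (+ 2 * h - 1ℤ) + b * (h + r * r + s * s)) → x ≋ y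
  modulo {x} {y} a b eq
    = ≋-intro (a * k + b * l) (begin
      x                                                           ≡⟨ eq ⟩
      y + (a * (+ 2 * h - 1ℤ) + b * (h + r * r + s * s))
        ≡⟨ cong₂ (λ u v → y + (a * (u - 1ℤ) + b * v)) 2h≡ e≡ ⟩
      y + (a * (1ℤ + + m * k - 1ℤ) + b * (0ℤ + + m * l))          ≡⟨ solve 6 (λ y a b m k l →
        y :+ (a :* (con 1ℤ :+ m :* k :- con 1ℤ) :+ b :* (con 0ℤ :+ m :* l))
        := y :+ m :* (a :* k :+ b :* l)) refl y a b (+ m) k l ⟩
      y + + m * (a * k + b * l)                                   ∎)
    where
    open +-*-Solver
    k = proj₁ (≋-quotient 2h≋1)
    l = proj₁ (≋-quotient h+r²+s²≋0)
    2h≡ = proj₂ (≋-quotient 2h≋1)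
    e≡ = proj₂ (≋-quotient h+r²+s²≋0)

  h*2* : ∀ a → h * (+ 2 * a) ≋ a
  h*2* a = modulo a 0ℤ (solve 4 (λ h r s a → h :* (con (+ 2) :* a)
    := a :+ (a :* (con (+ 2) :* h :- con 1ℤ) :+ con 0ℤ :* (h :+ r :* r :+ s :* s))) refl h r s a)
    where open +-*-Solver

  h•2• : ∀ x → h • + 2 • x ≋⁴ x
  h•2• ⟨ a , b , c , d ⟩ = pointwise (h*2* a) (h*2* b) (h*2* c) (h*2* d)

  ≈-fromℤ⁴ : ∀ q → q H/m.≈ fromℤ⁴ (h • doubled q)
  ≈-fromℤ⁴ q@(q′ , q∈H) =
    -- With 2 h = 1 + m k one has q = h (2q) + m (- k q), which gives the witness - k q.
    H/m-intro q (fromℤ⁴ (h • doubled q)) (ι (- k) ℍ.* q′ , ι*-closed (- k) q∈H) (sym (begin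
      proj₁ (fromℤ⁴ (h • doubled q)) ℍ.+ ι (+ m) ℍ.* (ι (- k) ℍ.* q′)
        ≡⟨ cong₂ ℍ._+_ (proj₁-fromℤ⁴ (h • doubled q)) (ι*ι* (+ m) (- k)) ⟩
      toℍ (h • doubled q) ℍ.+ ι (+ m * - k) ℍ.* q′
        ≡⟨ cong (ℍ._+ ι (+ m * - k) ℍ.* q′) (ι*toℍ h (doubled q)) ⟨
      ι h ℍ.* toℍ (doubled q) ℍ.+ ι (+ m * - k) ℍ.* q′
        ≡⟨ cong (λ x → ι h ℍ.* x ℍ.+ ι (+ m * - k) ℍ.* q′) (ι2*≡toℍ-doubled q) ⟨
      ι h ℍ.* (ι (+ 2) ℍ.* q′) ℍ.+ ι (+ m * - k) ℍ.* q′
        ≡⟨ cong (ℍ._+ ι (+ m * - k) ℍ.* q′) (ι*ι* h (+ 2)) ⟩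
      ι (h * + 2) ℍ.* q′ ℍ.+ ι (+ m * - k) ℍ.* q′
        ≡⟨ ℍ.distribʳ q′ (ι (h * + 2)) (ι (+ m * - k)) ⟨
      (ι (h * + 2) ℍ.+ ι (+ m * - k)) ℍ.* q′
        ≡⟨ cong (ℍ._* q′) (ι-homo-+ (h * + 2) (+ m * - k)) ⟨
      ι (h * + 2 + + m * - k) ℍ.* q′
        ≡⟨ cong (λ n → ι n ℍ.* q′) (begin
             h * + 2 + + m * - k           ≡⟨ cong (λ x → x + + m * - k) (trans (ℤ.*-comm h (+ 2)) 2h≡) ⟩
             1ℤ + + m * k + + m * - k      ≡⟨ solve 2 (λ m k →
               con 1ℤ :+ m :* k :+ m :* :- k := con 1ℤ) refl (+ m) k ⟩
             1ℤ                            ∎) ⟩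
      ι 1ℤ ℍ.* q′
        ≡⟨ ℍ.*-identityˡ q′ ⟩
      q′ ∎))
    where
    open +-*-Solver
    k = proj₁ (≋-quotient 2h≋1)
    2h≡ = proj₂ (≋-quotient 2h≋1)

    ι*ι* : ∀ a b → ι a ℍ.* (ι b ℍ.* q′) ≡ ι (a * b) ℍ.* q′
    ι*ι* a b = trans (sym (ℍ.*-assoc (ι a) (ι b) q′)) (cong (ℍ._* q′) (sym (ι-homo-* a b)))

  -- Here δ - α = 4 (r c + s d) and β + γ = 4 (r d - s c), so the combinations in `σ` isolate 4 (r²
  -- + s²) c and 4 (r² + s²) d. As r² + s² ≡ -h, the factor - h turns them into 4 h² c and 4 h² d,
  -- and 4 h² - 1 = (2 h + 1)(2 h - 1).
  σ-τ′ : ∀ x → σ h r s (τ′ x) ≋⁴ x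
  σ-τ′ ⟨ a , b , c , d ⟩ = pointwise
    (≋-trans (≋-reflexive (cong (h *_) (solve 5 (λ r s a c d →
      α r s a c d :+ δ r s a c d := con (+ 2) :* a) refl r s a c d))) (h*2* a))
    (≋-trans (≋-reflexive (cong (h *_) (solve 5 (λ r s b c d →
      β r s b c d :- γ r s b c d := con (+ 2) :* b) refl r s b c d))) (h*2* b))
    (modulo (c * (+ 2 * h + 1ℤ)) (- (+ 4 * (h * c))) (solve 7 (λ h r s a b c d →
      :- h :* (r :* (δ r s a c d :- α r s a c d) :- s :* (β r s b c d :+ γ r s b c d))
      := c :+ (c :* (con (+ 2) :* h :+ con 1ℤ) :* (con (+ 2) :* h :- con 1ℤ)
        :+ :- (con (+ 4) :* (h :* c)) :* (h :+ r :* r :+ s :* s))) refl h r s a b c d))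
    (modulo (d * (+ 2 * h + 1ℤ)) (- (+ 4 * (h * d))) (solve 7 (λ h r s a b c d →
      :- h :* (r :* (β r s b c d :+ γ r s b c d) :+ s :* (δ r s a c d :- α r s a c d))
      := d :+ (d :* (con (+ 2) :* h :+ con 1ℤ) :* (con (+ 2) :* h :- con 1ℤ)
        :+ :- (con (+ 4) :* (h :* d)) :* (h :+ r :* r :+ s :* s))) refl h r s a b c d))
    where open Polynomials

  -- The first entry is h (α + δ) + 2 h (r² + s²) (δ - α). Replacing r² + s² by - h and 2 h² by h
  -- leaves 2 h α ≡ α; the cofactors record these replacements. The other entries collapse alike,
  -- with β + γ in place of δ - α off the diagonal.
  τ′-σ : ∀ A → τ′ (σ h r s A) M/m.≈ A
  τ′-σ (mat α β γ δ) = mat≋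
    (modulo ((h + 1ℤ) * α - h * δ) (+ 2 * h * (δ - α)) (solve 7 (λ h r s α β γ δ →
      q₁ h α δ :- t :* r :* q₃ h r s α β γ δ :- t :* s :* q₄ h r s α β γ δ
      := α :+ (((h :+ con 1ℤ) :* α :- h :* δ) :* (t :* h :- con 1ℤ)
        :+ t :* h :* (δ :- α) :* (h :+ r :* r :+ s :* s))) refl h r s α β γ δ))
    (modulo ((h + 1ℤ) * β + h * γ) (- (+ 2 * h * (β + γ))) (solve 7 (λ h r s α β γ δ →
      q₂ h β γ :- t :* s :* q₃ h r s α β γ δ :+ t :* r :* q₄ h r s α β γ δ
      := β :+ (((h :+ con 1ℤ) :* β :+ h :* γ) :* (t :* h :- con 1ℤ)
        :+ :- (t :* h :* (β :+ γ)) :* (h :+ r :* r :+ s :* s))) refl h r s α β γ δ))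
    (modulo ((h + 1ℤ) * γ + h * β) (- (+ 2 * h * (β + γ))) (solve 7 (λ h r s α β γ δ →
      :- q₂ h β γ :- t :* s :* q₃ h r s α β γ δ :+ t :* r :* q₄ h r s α β γ δ
      := γ :+ (((h :+ con 1ℤ) :* γ :+ h :* β) :* (t :* h :- con 1ℤ)
        :+ :- (t :* h :* (β :+ γ)) :* (h :+ r :* r :+ s :* s))) refl h r s α β γ δ))
    (modulo ((h + 1ℤ) * δ - h * α) (- (+ 2 * h * (δ - α))) (solve 7 (λ h r s α β γ δ →
      q₁ h α δ :+ t :* r :* q₃ h r s α β γ δ :+ t :* s :* q₄ h r s α β γ δ
      := δ :+ (((h :+ con 1ℤ) :* δ :- h :* α) :* (t :* h :- con 1ℤ)
        :+ :- (t :* h :* (δ :- α)) :* (h :+ r :* r :+ s :* s))) refl h r s α β γ δ))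
    where
    open +-*-Solver
    t : ∀ {n} → Polynomial n
    t = con (+ 2)

    q₁ q₂ : ∀ {n} (h x y : Polynomial n) → Polynomial n
    q₁ h α δ = h :* (α :+ δ)
    q₂ h β γ = h :* (β :- γ)

    q₃ q₄ : ∀ {n} (h r s α β γ δ : Polynomial n) → Polynomial n
    q₃ h r s α β γ δ = :- h :* (r :* (δ :- α) :- s :* (β :+ γ))
    q₄ h r s α β γ δ = :- h :* (r :* (β :+ γ) :+ s :* (δ :- α))

  -- 2 + 4 (r² + s²) = 4 (h + r² + s²) - 2 (2 h - 1)
  modulo′ : ∀ {x y} a → x ≡ y + a * (+ 2 + + 4 * (r * r + s * s)) → x ≋ y
  modulo′ {x} {y} a eq = modulo (- (+ 2 * a)) (+ 4 * a) (trans eq (solve 5 (λ h r s y a →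
    y :+ a :* (con (+ 2) :+ con (+ 4) :* (r :* r :+ s :* s))
    := y :+ (:- (con (+ 2) :* a) :* (con (+ 2) :* h :- con 1ℤ)
      :+ con (+ 4) :* a :* (h :+ r :* r :+ s :* s))) refl h r s y a))
    where open +-*-Solver

  τ′-⊕ : ∀ x y → τ′ (x ⊕ y) M/m.≈ τ′ x M/m.+ τ′ y
  τ′-⊕ ⟨ a , b , c , d ⟩ ⟨ e , f , g , i ⟩ = mat≋
    (≋-reflexive (solve 8 (λ r s a c d e g i →
      α r s (a :+ e) (c :+ g) (d :+ i) := α r s a c d :+ α r s e g i) refl r s a c d e g i))
    (≋-reflexive (solve 8 (λ r s b c d f g i →
      β r s (b :+ f) (c :+ g) (d :+ i) := β r s b c d :+ β r s f g i) refl r s b c d f g i))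
    (≋-reflexive (solve 8 (λ r s b c d f g i →
      γ r s (b :+ f) (c :+ g) (d :+ i) := γ r s b c d :+ γ r s f g i) refl r s b c d f g i))
    (≋-reflexive (solve 8 (λ r s a c d e g i →
      δ r s (a :+ e) (c :+ g) (d :+ i) := δ r s a c d :+ δ r s e g i) refl r s a c d e g i))
    where open Polynomials

  τ′-scalar : ∀ n → τ′ ⟨ n , 0ℤ , 0ℤ , 0ℤ ⟩ M/m.≈ mat n 0ℤ 0ℤ n
  τ′-scalar n = mat≋
    (≋-reflexive (solve 3 (λ r s n → α r s n o o := n) refl r s n))
    (≋-reflexive (solve 2 (λ r s → β r s o o o := o) refl r s))
    (≋-reflexive (solve 2 (λ r s → γ r s o o o := o) refl r s))
    (≋-reflexive (solve 3 (λ r s n → δ r s n o o := n) refl r s n))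
    where
    open Polynomials
    o : ∀ {n} → Polynomial n
    o = con 0ℤ

  -- Products with τ′ (i) are respected exactly. Only J², K², J K and K J are off, by multiples of 2
  -- + 4 (r² + s²): the squares contribute c g + d i on the diagonal, the mixed products c i - d g
  -- off it.
  τ′-⋆ : ∀ x y → τ′ (x ⋆ y) M/m.≈ τ′ x M/m.* τ′ y
  τ′-⋆ ⟨ a , b , c , d ⟩ ⟨ e , f , g , i ⟩ = mat≋
    (modulo′ (- (c * g + d * i)) (solve 10 (λ r s a b c d e f g i →
      α r s (⋆₁ a b c d e f g i) (⋆₃ a b c d e f g i) (⋆₄ a b c d e f g i)
      := α r s a c d :* α r s e g i :+ β r s b c d :* γ r s f g i
        :+ :- (c :* g :+ d :* i) :* w r s) refl r s a b c d e f g i))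
    (modulo′ (c * i - d * g) (solve 10 (λ r s a b c d e f g i →
      β r s (⋆₂ a b c d e f g i) (⋆₃ a b c d e f g i) (⋆₄ a b c d e f g i)
      := α r s a c d :* β r s f g i :+ β r s b c d :* δ r s e g i
        :+ (c :* i :- d :* g) :* w r s) refl r s a b c d e f g i))
    (modulo′ (- (c * i - d * g)) (solve 10 (λ r s a b c d e f g i →
      γ r s (⋆₂ a b c d e f g i) (⋆₃ a b c d e f g i) (⋆₄ a b c d e f g i)
      := γ r s b c d :* α r s e g i :+ δ r s a c d :* γ r s f g i
        :+ :- (c :* i :- d :* g) :* w r s) refl r s a b c d e f g i))
    (modulo′ (- (c * g + d * i)) (solve 10 (λ r s a b c d e f g i →
      δ r s (⋆₁ a b c d e f g i) (⋆₃ a b c d e f g i) (⋆₄ a b c d e f g i)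
      := γ r s b c d :* β r s f g i :+ δ r s a c d :* δ r s e g i
        :+ :- (c :* g :+ d :* i) :* w r s) refl r s a b c d e f g i))
    where open Polynomials

  -- From (r c + s d)² + (r d - s c)² = (r² + s²)(c² + d²), the determinant equals a² + b² - 4 (r² +
  -- s²)(c² + d²), and -4 (r² + s²) ≡ 2.
  det-τ′ : ∀ x → det (ℤ/ m) (τ′ x) ≋ norm x
  det-τ′ ⟨ a , b , c , d ⟩ = modulo′ (- (c * c + d * d)) (solve 6 (λ r s a b c d →
    α r s a c d :* δ r s a c d :- β r s b c d :* γ r s b c d
    := a :* a :+ b :* b :+ con (+ 2) :* (c :* c) :+ con (+ 2) :* (d :* d)
      :+ :- (c :* c :+ d :* d) :* w r s) refl r s a b c d)
    where open Polynomials

  det-τ : ∀ q → det (ℤ/ m) (τ q) ≋ norm₁₂₂ q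
  det-τ q = ≋-trans (det-τ′ (h • x)) (≋-trans (≋-reflexive (begin
      norm (h • x)                          ≡⟨ solve 5 (λ h a b c d →
        h :* a :* (h :* a) :+ h :* b :* (h :* b)
          :+ t :* (h :* c :* (h :* c)) :+ t :* (h :* d :* (h :* d))
        := h :* (h :* (a :* a :+ b :* b :+ t :* (c :* c) :+ t :* (d :* d))))
        refl h (ℤ⁴.x₁ x) (ℤ⁴.x₂ x) (ℤ⁴.x₃ x) (ℤ⁴.x₄ x) ⟩
      h * (h * norm x)                      ≡⟨ cong (λ n → h * (h * n)) (norm-doubled q) ⟩
      h * (h * (+ 2 * (+ 2 * norm₁₂₂ q)))   ∎))
    (≋-trans (*-congˡ h (h*2* (+ 2 * norm₁₂₂ q))) (h*2* (norm₁₂₂ q))))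
    where
    x = doubled q
    open +-*-Solver
    t : ∀ {n} → Polynomial n
    t = con (+ 2)

  -- Independence of the representative: every x in L congruent to q has the coordinates of h (2q)
  -- modulo m.
  h•doubled-mod : ∀ q x → q H/m.≈ fromℤ⁴ x → h • doubled q ≋⁴ x
  h•doubled-mod q x q≈x = ≋⁴-trans {h • doubled q} {h • doubled (fromℤ⁴ x)} {x}
    (•-cong h {doubled q} {doubled (fromℤ⁴ x)} (doubled-mod q (fromℤ⁴ x) q≈x))
    (subst (λ y → h • y ≋⁴ x) (sym (doubled-fromℤ⁴ x)) (h•2• x))

  τ-mod : ∀ q x → q H/m.≈ fromℤ⁴ x → τ q M/m.≈ τ′ x
  τ-mod q x q≈x = τ′-cong {h • doubled q} {x} (h•doubled-mod q x q≈x)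

  τ-cong : ∀ p q → p H/m.≈ q → τ p M/m.≈ τ q
  τ-cong p q p≈q = τ′-cong {h • doubled p} {h • doubled q}
    (•-cong h {doubled p} {doubled q} (doubled-mod p q p≈q))

  τ-homo-+ : ∀ p q → τ (p H.+ q) M/m.≈ τ p M/m.+ τ q
  τ-homo-+ p q = M/m.trans
    (τ′-cong (≋⁴-reflexive (trans (cong (h •_) (doubled-homo-+ p q))
      (•-distribˡ-⊕ h (doubled p) (doubled q)))))
    (τ′-⊕ (h • doubled p) (h • doubled q))

  τ-homo-* : ∀ p q → τ (p H.* q) M/m.≈ τ p M/m.* τ q
  τ-homo-* p q = M/m.trans
    -- A factor 2 h ≡ 1 is inserted to supply the 2 required by `doubled-homo-*`; the two factors h
    -- are then shared between p and q.
    (τ′-cong (≋⁴-trans (•-cong h (≋⁴-sym (h•2• (doubled (p H.* q))))) (≋⁴-reflexive (begin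
      h • h • + 2 • doubled (p H.* q)         ≡⟨ cong (λ x → h • h • x) (doubled-homo-* p q) ⟩
      h • h • (doubled p ⋆ doubled q)         ≡⟨ •-⋆-• h (doubled p) (doubled q) ⟨
      (h • doubled p) ⋆ (h • doubled q)       ∎))))
    (τ′-⋆ (h • doubled p) (h • doubled q))

  τ-homo-- : ∀ q → τ (H.- q) M/m.≈ M/m.- τ q
  τ-homo-- q = M/m.trans
    (τ′-cong (≋⁴-reflexive (cong (h •_) (doubled-homo-- q))))
    (τ′-• (doubled q))
    where
    open Polynomials

    τ′-• : ∀ x → τ′ (h • -1ℤ • x) M/m.≈ M/m.- τ′ (h • x)
    τ′-• ⟨ a , b , c , d ⟩ = mat≋
      (≋-reflexive (solve 6 (λ h r s a c d →
        α r s (h :* (n :* a)) (h :* (n :* c)) (h :* (n :* d))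
        := :- α r s (h :* a) (h :* c) (h :* d)) refl h r s a c d))
      (≋-reflexive (solve 6 (λ h r s b c d →
        β r s (h :* (n :* b)) (h :* (n :* c)) (h :* (n :* d))
        := :- β r s (h :* b) (h :* c) (h :* d)) refl h r s b c d))
      (≋-reflexive (solve 6 (λ h r s b c d →
        γ r s (h :* (n :* b)) (h :* (n :* c)) (h :* (n :* d))
        := :- γ r s (h :* b) (h :* c) (h :* d)) refl h r s b c d))
      (≋-reflexive (solve 6 (λ h r s a c d →
        δ r s (h :* (n :* a)) (h :* (n :* c)) (h :* (n :* d))
        := :- δ r s (h :* a) (h :* c) (h :* d)) refl h r s a c d))
      where
      n : ∀ {k} → Polynomial k
      n = con -1ℤ

  -- Covers both 0 and 1, for which the hypothesis holds by computation.
  τ-scalar : ∀ q n → ι (+ 2) ℍ.* proj₁ q ≡ ι (+ 2 * n) → τ q M/m.≈ mat n 0ℤ 0ℤ n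
  τ-scalar q n eq = M/m.trans
    (τ′-cong {h • doubled q} {x} (subst (λ y → h • y ≋⁴ x) (sym (doubled-unique q eq)) (h•2• x)))
    (τ′-scalar n)
    where x = ⟨ n , 0ℤ , 0ℤ , 0ℤ ⟩

  -- `σ` recovers the coordinates of h (2p) from the matrix, and these determine the class of p.
  τ-injective : ∀ {p q} → τ p M/m.≈ τ q → p H/m.≈ q
  τ-injective {p} {q} τp≈τq =
    H/m.trans {p} {p′} {q} (≈-fromℤ⁴ p)
      (H/m.trans {p′} {q′} {q} (fromℤ⁴-cong (≋⁴-trans (≋⁴-sym (σ-τ′ (h • doubled p)))
          (≋⁴-trans (σ-cong τp≈τq) (σ-τ′ (h • doubled q)))))
        (H/m.sym {q} {q′} (≈-fromℤ⁴ q)))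
    where
    p′ = fromℤ⁴ (h • doubled p)
    q′ = fromℤ⁴ (h • doubled q)

  isRingIsomorphism : IsRingIsomorphism (Ring.rawRing (H₁₂₂/ m)) (Ring.rawRing (M₂ (ℤ/ m))) τ
  isRingIsomorphism = record
    { isRingMonomorphism = record
      { isRingHomomorphism = record
        { isSemiringHomomorphism = record
          { isNearSemiringHomomorphism = record
            { +-isMonoidHomomorphism = record
              { isMagmaHomomorphism = record
                { isRelHomomorphism = record { cong = λ {p} {q} → τ-cong p q }
                ; homo = τ-homo-+
                }
              ; ε-homo = τ-scalar H.0# 0ℤ refl
              }
            ; *-homo = τ-homo-*
            }
          ; 1#-homo = τ-scalar H.1# 1ℤ refl
          }
        ; -‿homo = τ-homo--
        }
      ; injective = λ {p} {q} → τ-injective {p} {q}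
      }
    -- Setoid surjectivity asks that every q congruent to the preimage be sent to `A`, hence `τ-mod`
    -- before `τ′-σ`.
    ; surjective = λ A → fromℤ⁴ (σ h r s A) , λ {q} q≈ →
        M/m.trans (τ-mod q (σ h r s A) q≈) (τ′-σ A)
    }

theorem26 :
    ∀ (m : ℕ) → 2 ∤ m →
    let _≡[m]_  = CommutativeRing._≈_ (ℤ/ m)
        _≡[mH]_ = Ring._≈_ (H₁₂₂/ m)
        _≡[M₂]_ = Ring._≈_ (M₂ (ℤ/ m))
    in
    ∀ (2⁻¹ r s : ℤ) →
    (+ 2 * 2⁻¹) ≡[m] 1ℤ →
    (2⁻¹ + r * r + s * s) ≡[m] 0ℤ →
    (∀ (q : H₁₂₂) → ∃[ q₁ ] ∃[ q₂ ] ∃[ q₃ ] ∃[ q₄ ] (q ≡[mH] integral q₁ q₂ q₃ q₄))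
    × (Σ[ τ ∈ (H₁₂₂ → Matrix₂ ℤ) ]
        (∀ (q : H₁₂₂) (q₁ q₂ q₃ q₄ : ℤ) →
           q ≡[mH] integral q₁ q₂ q₃ q₄ → τ q ≡[M₂] τ-matrix r s q₁ q₂ q₃ q₄)
      × IsRingIsomorphism (Ring.rawRing (H₁₂₂/ m)) (Ring.rawRing (M₂ (ℤ/ m))) τ
      × (∀ (q : H₁₂₂) → ∃[ n ] (N (proj₁ q) ≡ ι n × det (ℤ/ m) (τ q) ≡[m] n)))
theorem26 m _ 2⁻¹ r s 2*2⁻¹≈1 2⁻¹+r²+s²≈0 =
    (λ q → let x = 2⁻¹ • doubled q in x₁ x , x₂ x , x₃ x , x₄ x , ≈-fromℤ⁴ q)
  , τ
  , (λ q q₁ q₂ q₃ q₄ → τ-mod q ⟨ q₁ , q₂ , q₃ , q₄ ⟩)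
  , isRingIsomorphism
  , (λ q → norm₁₂₂ q , N≡ι-norm₁₂₂ q , ≋⇒≈ (det-τ q))
  where
  open ℤ⁴
  open Congruence m using ([_]; ≋⇒≈)
  open Isomorphism m 2⁻¹ r s [ 2*2⁻¹≈1 ] [ 2⁻¹+r²+s²≈0 ]
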